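{- Let $s$ be the Brouwer threshold. Then every quiver $G$ with $\lambda_1(G)\le s$ satisfies $S_k(G)\le B_k(G)$ for all $1\le k\le n(G)$.
   Context: A quiver $G$ is a finite undirected graph with $n=n(G)\ge 1$ vertices in which loops (possibly several at the same vertex) and multiple edges between distinct vertices are allowed. $m$ is the total number of edges, where every loop and every edge of a multiple connection is counted. A finite simple graph is a quiver with no loops and no multiple connections. The Kirchhoff matrix $K$ of $G$ is the symmetric $n\times n$ matrix with $K_{ij}=-(\text{number of edges between } i \text{ and } j)$ for $i\neq j$, and $K_{ii}=$ the degree of vertex $i$, i.e. the number of edges attached to $i$, counted with multiplicity, where each loop at $i$ counts as $1$. Its eigenvalues are $\lambda_1(G)\ge\lambda_2(G)\ge\dots\ge\lambda_n(G)$, and $S_k(G)=\sum_{j=1}^k\lambda_j(G)$. The redundancy $r$ is the minimal number of edges whose removal leaves no multiple connections between distinct vertices; equivalently $r=\sum_{i<j}(\mathrm{sign}(K_{ij})-K_{ij})$ (multiple loops at a vertex do not count as redundant). Set $B_k(G)=m+r+k(k+1)/2$; for a finite simple graph $r=0$. The Brouwer threshold $s$ is the largest number (possibly $\infty$) such that, for all finite simple graphs $G$, the estimate $S_k(G)\le B_k(G)$ holds for all $k\le s$ (with $1\le k\le n(G)$). -}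

module Defs where

open import Algebra.Bundles using (CommutativeRing)
import Algebra.Definitions.RawMonoid as RawMonoidDefinitions
import Algebra.Properties.Monoid.Sum as MonoidSum
open import Data.Bool.Base using (if_then_else_)
open import Data.Fin.Base using (Fin; fromℕ<; inject≤) renaming (_≤_ to _≤ᶠ_)
open import Data.Fin.Properties using (_≟_; _≤?_; _<?_)
open import Data.Integer.Base as ℤ using (ℤ; +_; +0; +[1+_]; -[1+_])
import Data.Integer.Properties as ℤ
import Data.Maybe.Base as Maybe
open import Data.Nat.Base as ℕ using (ℕ; suc; NonZero; >-nonZero⁻¹)
open import Data.Nat.DivMod using (_/_)
import Data.Nat.Properties as ℕ
open import Data.Product.Base using (∃; _×_)
open import Data.Vec.Functional using (Vector)
open import Level using (0ℓ)
import Relation.Binary.Construct.Add.Supremum.NonStrict as Sup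
open import Relation.Binary.Core using (Rel)
open import Relation.Binary.PropositionalEquality.Core using (_≡_; _≢_)
open import Relation.Binary.Structures using (IsDecTotalOrder)
open import Relation.Nullary.Construct.Add.Supremum using (_⁺; [_])
open import Relation.Nullary.Decidable.Core using (does)
open import Relation.Unary using (Pred; Satisfiable)

module ℕΣ = MonoidSum ℕ.+-0-monoid
module ℤΣ = MonoidSum ℤ.+-0-monoid

-- A complete ordered field.  The decidable total order makes these the
-- classical reals, which this axiomatisation determines up to isomorphism.
record RealNumbers : Set₁ where
  field
    commutativeRing : CommutativeRing 0ℓ 0ℓ

  open CommutativeRing commutativeRing public

  infix 4 _≤_
  field
    _≤_             : Rel Carrier 0ℓ
    isDecTotalOrder : IsDecTotalOrder _≈_ _≤_
    1#≉0#           : 1# ≉ 0#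
    inverse         : ∀ x → x ≉ 0# → ∃ λ y → x * y ≈ 1#
    +-monoʳ-≤       : ∀ x {y z} → y ≤ z → x + y ≤ x + z
    *-nonNeg        : ∀ {x y} → 0# ≤ x → 0# ≤ y → 0# ≤ x * y

  IsUpperBound : Pred Carrier 0ℓ → Carrier → Set
  IsUpperBound P u = ∀ {x} → P x → x ≤ u

  field
    leastUpperBound : ∀ P → Satisfiable P → ∃ (IsUpperBound P) →
                      ∃ λ u → IsUpperBound P u × (∀ {v} → IsUpperBound P v → u ≤ v)

-- For i ≢ j, edges i j is the number of edges joining i and j;
-- edges i i is the number of loops at i.
record Quiver (n : ℕ) : Set where
  field
    edges     : Fin n → Fin n → ℕ
    symmetric : ∀ i j → edges i j ≡ edges j i

signum : ℤ → ℤ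
signum +0       = +0
signum +[1+ _ ] = + 1
signum -[1+ _ ] = -[1+ 0 ]

module _ {n : ℕ} (G : Quiver n) where
  open Quiver G

  IsSimple : Set
  IsSimple = (∀ i → edges i i ≡ 0) × (∀ i j → i ≢ j → edges i j ℕ.≤ 1)

  edgeCount : ℕ
  edgeCount = ℕΣ.sum λ i → ℕΣ.sum λ j → if does (i ≤? j) then edges i j else 0

  -- The summand j = i makes every loop count once.
  degree : Fin n → ℕ
  degree i = ℕΣ.sum λ j → edges i j

  kirchhoff : Fin n → Fin n → ℤ
  kirchhoff i j = if does (i ≟ j) then + degree i else ℤ.- (+ edges i j)

  -- For i < j the summand is 0 if edges i j is 0 and edges i j - 1 otherwise: the
  -- number of edges to remove so that i and j are no longer multiply connected.
  redundancy : ℤ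
  redundancy = ℤΣ.sum λ i → ℤΣ.sum λ j →
    if does (i <? j) then signum (kirchhoff i j) ℤ.- kirchhoff i j else +0

  brouwerBound : ℕ → ℤ
  brouwerBound k = + edgeCount ℤ.+ redundancy ℤ.+ + (k ℕ.* suc k / 2)

module Spectral (ℝ : RealNumbers) where
  open RealNumbers ℝ
  open MonoidSum +-monoid using (sum)
  open RawMonoidDefinitions +-rawMonoid using () renaming (_×_ to _×ᴿ_)

  fromℕ : ℕ → Carrier
  fromℕ k = k ×ᴿ 1#

  fromℤ : ℤ → Carrier
  fromℤ (+ k)    = fromℕ k
  fromℤ -[1+ k ] = - fromℕ (suc k)

  LinearlyIndependent : ∀ {m n} → (Fin m → Vector Carrier n) → Set
  LinearlyIndependent {m} v =
    ∀ (c : Vector Carrier m) → (∀ i → sum (λ j → c j * v j i) ≈ 0#) → ∀ j → c j ≈ 0#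

  EigenEquation : ∀ {n} → (Fin n → Fin n → ℤ) → Carrier → Vector Carrier n → Set
  EigenEquation A μ v = ∀ i → sum (λ j → fromℤ (A i j) * v j) ≈ μ * v i

  -- The eigenvalues of a symmetric n × n matrix in decreasing order, repeated
  -- according to the dimensions of the eigenspaces: n independent eigenvectors
  -- contain a basis of each eigenspace.
  IsSpectrum : ∀ {n} → (Fin n → Fin n → ℤ) → Vector Carrier n → Set
  IsSpectrum {n} A eig =
    (∀ {i j : Fin n} → i ≤ᶠ j → eig j ≤ eig i) ×
    ∃ λ (v : Fin n → Vector Carrier n) →
      LinearlyIndependent v × (∀ j → EigenEquation A (eig j) (v j))

  largest : ∀ {n} .{{_ : NonZero n}} → Vector Carrier n → Carrier
  largest {n} eig = eig (fromℕ< (>-nonZero⁻¹ n))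

  partialSum : ∀ {n} → Vector Carrier n → ∀ k → k ℕ.≤ n → Carrier
  partialSum eig k k≤n = sum {k} λ j → eig (inject≤ j k≤n)

  -- In ℕ ⁺ and Carrier ⁺ the added supremum is ∞.
  open Sup ℕ._≤_ public using () renaming (_≤⁺_ to _≤ℕ⁺_)
  open Sup _≤_   public using () renaming (_≤⁺_ to _≤ℝ⁺_)

  fromℕ⁺ : ℕ ⁺ → Carrier ⁺
  fromℕ⁺ = Maybe.map fromℕ

  BrouwerEstimateUpTo : ℕ ⁺ → Set
  BrouwerEstimateUpTo t =
    ∀ n .{{_ : NonZero n}} (G : Quiver n) → IsSimple G →
    (eig : Vector Carrier n) → IsSpectrum (kirchhoff G) eig →
    ∀ k → 1 ℕ.≤ k → (k≤n : k ℕ.≤ n) → [ k ] ≤ℕ⁺ t →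
    partialSum eig k k≤n ≤ fromℤ (brouwerBound G k)

  -- The estimate only concerns integers k, so a finite threshold is a natural number.
  IsBrouwerThreshold : ℕ ⁺ → Set
  IsBrouwerThreshold s =
    BrouwerEstimateUpTo s × (∀ t → BrouwerEstimateUpTo t → t ≤ℕ⁺ s)

{-# OPTIONS --safe #-}

-- Write K_G = K_{G₀} + K_{G₁}, where G₀ is the simple graph underlying G and G₁ consists of the loops
-- and the redundant edges.  K_{G₁} is positive semidefinite, and its trace, one for each loop and two
-- for each redundant edge, is B_k(G) - B_k(G₀).  By Ky Fan, adding a positive semidefinite matrix
-- raises S_k by at most its trace, so the estimate passes from G₀ to G as long as k ≤ s.  For larger k
-- the sum grows by λ_k ≤ λ₁ ≤ s < k in each step and the bound by k.
--
-- The spectrum of K_{G₀} has to be constructed.  On the orthogonal complement W of the eigenvectors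
-- already found, let μ be the supremum of the Rayleigh quotient of A.  Then μ - A is positive
-- semidefinite on W; if it were invertible there, Cauchy-Schwarz would give μ - A ≥ ε > 0 on W,
-- against the choice of μ.  So μ is an eigenvalue, and neither compactness nor square roots are needed.
module Submission where

open import Defs
import Algebra.Properties.CommutativeMonoid.Sum as CommutativeMonoidSum
import Algebra.Properties.Ring as RingProperties
import Algebra.Properties.Semiring.Mult as SemiringMult
import Algebra.Properties.Semiring.Sum as SemiringSum
import Algebra.Solver.Ring as RingSolver
open import Algebra.Solver.Ring.AlmostCommutativeRing
  using (fromCommutativeRing; _-Raw-AlmostCommutative⟶_)
open import Data.Bool.Base using (true; false; if_then_else_)
open import Data.Fin.Base as Fin using (Fin; zero; suc; punchIn)
import Data.Fin.Properties as Fin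
open import Data.Integer.Base as ℤ using (ℤ; +_; -[1+_]; +0; +[1+_])
import Data.Integer.Properties as ℤ
open import Data.Maybe.Base as Maybe using (Maybe)
open import Data.Nat.Base as ℕ using (ℕ; zero; suc; NonZero)
open import Data.Nat.Divisibility using (divides-refl)
open import Data.Nat.DivMod using (_/_; +-distrib-/-∣ʳ; m*n/n≡m)
import Data.Nat.Properties as ℕ
import Data.Nat.Tactic.RingSolver as ℕSolver
open import Data.Product.Base using (∃; _×_; _,_; proj₁; proj₂)
open import Data.Sum.Base using (_⊎_; inj₁; inj₂)
open import Data.Vec.Functional using (Vector; _∷_; insertAt)
open import Data.Vec.Functional.Properties using (insertAt-lookup; insertAt-punchIn)
open import Function.Base using (_∘_; case_of_)
open import Relation.Binary.Bundles using (DecTotalOrder)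
import Relation.Binary.Construct.Add.Supremum.NonStrict as Sup
open import Relation.Binary.Definitions using (tri<; tri≈; tri>)
open import Relation.Binary.PropositionalEquality as ≡ using (_≡_; _≢_)
import Relation.Binary.Reasoning.Setoid as SetoidReasoning
open import Relation.Nullary using (¬_; Dec; yes; no; contradiction; does)
open import Relation.Nullary.Construct.Add.Supremum using (_⁺; [_]; ⊤⁺)
open import Relation.Nullary.Decidable using (dec-true; dec-false; dec⇒maybe)

-- The eigenvectors supplied for K_G are merely independent, whereas Ky Fan needs orthogonal ones.
-- So orthogonal eigenbases are built for K_G as well as for K_{G₀}, and the given eigenvalues of
-- K_G are bounded above, index by index, by the constructed ones.
--
-- What the axioms of `RealNumbers` offer is a decidable order and suprema, but no excluded middle.
-- The alternative "singular or invertible" must therefore come out of Gaussian elimination. To run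
-- it without choosing a basis of W, the matrix B = μ - A is replaced by the operator BP + (1 - P)
-- on the whole space, where P projects onto W. As B preserves W, this operator is singular exactly
-- when B is singular on W. The projection is available only through explicit splittings of vectors,
-- which are updated whenever a new eigenvector is found.
--
-- In the invertible case there are vectors y_l in W with x_l = x ∙ By_l for all x in W.
-- Cauchy-Schwarz for the form of B then bounds each coordinate of x, and summing over the
-- coordinates bounds x ∙ x by a multiple of x ∙ Bx; ε is the inverse of that multiple.

-- Ordered fields and homogeneous linear systems

module OrderedField (ℝ : RealNumbers) where
  open RealNumbers ℝ public hiding (zero)
  open Spectral ℝ public using (fromℕ; fromℤ)
  open SemiringSum semiring public
  open SemiringMult semiring using (×-homo-+; ×1-homo-*)
  open RingProperties ring public
    using (-1*x≈-x; -‿+-comm; -‿involutive; -0#≈0#; -‿distribˡ-*; -‿distribʳ-*)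
  module ≈-Reasoning = SetoidReasoning setoid

  order : DecTotalOrder _ _ _
  order = record { isDecTotalOrder = isDecTotalOrder }

  module Order = DecTotalOrder order
  open Order public using (_≟_; _≤?_; total; antisym)
    renaming (refl to ≤-refl; reflexive to ≤-reflexive; trans to ≤-trans)

  fromℤ-⊖ : ∀ m n → fromℤ (m ℤ.⊖ n) ≈ fromℕ m - fromℕ n
  fromℤ-⊖ zero    zero    = sym (-‿inverseʳ 0#)
  fromℤ-⊖ zero    (suc n) = sym (+-identityˡ _)
  fromℤ-⊖ (suc m) zero    = sym (trans (+-congˡ -0#≈0#) (+-identityʳ _))
  fromℤ-⊖ (suc m) (suc n) = begin
    fromℤ (suc m ℤ.⊖ suc n)              ≡⟨ ≡.cong fromℤ (ℤ.[1+m]⊖[1+n]≡m⊖n m n) ⟩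
    fromℤ (m ℤ.⊖ n)                      ≈⟨ fromℤ-⊖ m n ⟩
    fromℕ m - fromℕ n                    ≈⟨ +-congʳ (+-identityˡ _) ⟨
    0# + fromℕ m - fromℕ n               ≈⟨ +-congʳ (+-congʳ (-‿inverseʳ 1#)) ⟨
    1# - 1# + fromℕ m - fromℕ n          ≈⟨ +-congʳ (trans (+-assoc _ _ _) (trans (+-congˡ (+-comm _ _)) (sym (+-assoc _ _ _)))) ⟩
    1# + fromℕ m + - 1# - fromℕ n        ≈⟨ +-assoc _ _ _ ⟩
    1# + fromℕ m + (- 1# - fromℕ n)      ≈⟨ +-congˡ (-‿+-comm _ _) ⟩
    fromℕ (suc m) - fromℕ (suc n)        ∎
    where open ≈-Reasoning

  fromℤ-neg : ∀ a → fromℤ (ℤ.- a) ≈ - fromℤ a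
  fromℤ-neg +0       = sym -0#≈0#
  fromℤ-neg +[1+ n ] = refl
  fromℤ-neg -[1+ n ] = sym (-‿involutive _)

  fromℕ-+ : ∀ m n → fromℕ (m ℕ.+ n) ≈ fromℕ m + fromℕ n
  fromℕ-+ = ×-homo-+ 1#

  fromℤ-+ : ∀ a b → fromℤ (a ℤ.+ b) ≈ fromℤ a + fromℤ b
  fromℤ-+ (+ m)    (+ n)    = fromℕ-+ m n
  fromℤ-+ (+ m)    -[1+ n ] = fromℤ-⊖ m (suc n)
  fromℤ-+ -[1+ m ] (+ n)    = trans (fromℤ-⊖ n (suc m)) (+-comm _ _)
  fromℤ-+ -[1+ m ] -[1+ n ] = begin
    - fromℕ (suc (suc (m ℕ.+ n)))      ≡⟨ ≡.cong (λ k → - fromℕ (suc k)) (ℕ.+-suc m n) ⟨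
    - fromℕ (suc m ℕ.+ suc n)          ≈⟨ -‿cong (fromℕ-+ (suc m) (suc n)) ⟩
    - (fromℕ (suc m) + fromℕ (suc n))  ≈⟨ -‿+-comm _ _ ⟨
    - fromℕ (suc m) - fromℕ (suc n)    ∎
    where open ≈-Reasoning

  fromℤ-ℕ* : ∀ m b → fromℤ (+ m ℤ.* b) ≈ fromℕ m * fromℤ b
  fromℤ-ℕ* m (+ n) = begin
    fromℤ (+ m ℤ.* + n)  ≡⟨ ≡.cong fromℤ (ℤ.pos-* m n) ⟨
    fromℕ (m ℕ.* n)      ≈⟨ ×1-homo-* m n ⟩
    fromℕ m * fromℕ n    ∎
    where open ≈-Reasoning
  fromℤ-ℕ* m -[1+ n ] = begin
    fromℤ (+ m ℤ.* -[1+ n ])         ≡⟨ ≡.cong fromℤ (ℤ.neg-distribʳ-* (+ m) +[1+ n ]) ⟨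
    fromℤ (ℤ.- (+ m ℤ.* +[1+ n ]))   ≈⟨ fromℤ-neg (+ m ℤ.* +[1+ n ]) ⟩
    - fromℤ (+ m ℤ.* +[1+ n ])       ≈⟨ -‿cong (fromℤ-ℕ* m +[1+ n ]) ⟩
    - (fromℕ m * fromℕ (suc n))      ≈⟨ -‿distribʳ-* _ _ ⟩
    fromℕ m * - fromℕ (suc n)        ∎
    where open ≈-Reasoning

  fromℤ-* : ∀ a b → fromℤ (a ℤ.* b) ≈ fromℤ a * fromℤ b
  fromℤ-* (+ m)    b = fromℤ-ℕ* m b
  fromℤ-* -[1+ m ] b = begin
    fromℤ (-[1+ m ] ℤ.* b)           ≡⟨ ≡.cong fromℤ (ℤ.neg-distribˡ-* +[1+ m ] b) ⟨
    fromℤ (ℤ.- (+[1+ m ] ℤ.* b))     ≈⟨ fromℤ-neg (+[1+ m ] ℤ.* b) ⟩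
    - fromℤ (+[1+ m ] ℤ.* b)         ≈⟨ -‿cong (fromℤ-ℕ* (suc m) b) ⟩
    - (fromℕ (suc m) * fromℤ b)      ≈⟨ -‿distribˡ-* _ _ ⟩
    - fromℕ (suc m) * fromℤ b        ∎
    where open ≈-Reasoning

  -- Lets the ring solver compute with integer coefficients, so that it can cancel opposite terms.
  fromℤ-homomorphism : ℤ.+-*-rawRing -Raw-AlmostCommutative⟶ fromCommutativeRing commutativeRing
  fromℤ-homomorphism = record
    { ⟦_⟧    = fromℤ
    ; +-homo = fromℤ-+
    ; *-homo = fromℤ-*
    ; -‿homo = fromℤ-neg
    ; 0-homo = refl
    ; 1-homo = +-identityʳ 1#
    }

  _coefficient≟_ : ∀ a b → Maybe (fromℤ a ≈ fromℤ b)
  a coefficient≟ b = Maybe.map (λ a≡b → reflexive (≡.cong fromℤ a≡b)) (dec⇒maybe (a ℤ.≟ b))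

  module Solver = RingSolver ℤ.+-*-rawRing (fromCommutativeRing commutativeRing) fromℤ-homomorphism _coefficient≟_
  open Solver using (solve; _:=_; _:+_; _:*_; _:-_; :-_; con) public

  infix 4 _<_
  _<_ : Carrier → Carrier → Set
  x < y = ¬ (y ≤ x)

  <⇒≤ : ∀ {x y} → x < y → x ≤ y
  <⇒≤ {x} {y} x<y with total x y
  ... | inj₁ x≤y = x≤y
  ... | inj₂ y≤x = contradiction y≤x x<y

  ≤-resp₂ : ∀ {x x′ y y′} → x ≈ x′ → y ≈ y′ → x ≤ y → x′ ≤ y′
  ≤-resp₂ p q x≤y = ≤-trans (≤-reflexive (sym p)) (≤-trans x≤y (≤-reflexive q))

  +-mono-≤ : ∀ {a b c d} → a ≤ b → c ≤ d → a + c ≤ b + d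
  +-mono-≤ {a} {b} {c} {d} a≤b c≤d = ≤-trans (+-monoʳ-≤ a c≤d)
    (≤-resp₂ (+-comm d a) (+-comm d b) (+-monoʳ-≤ d a≤b))

  x≤y⇒0≤y-x : ∀ {x y} → x ≤ y → 0# ≤ y - x
  x≤y⇒0≤y-x {x} {y} x≤y = ≤-resp₂ (-‿inverseˡ x) (+-comm _ _) (+-monoʳ-≤ (- x) x≤y)

  0≤y-x⇒x≤y : ∀ {x y} → 0# ≤ y - x → x ≤ y
  0≤y-x⇒x≤y {x} {y} p = ≤-resp₂ (+-identityʳ x)
    (solve 2 (λ x y → x :+ (y :- x) := y) refl x y) (+-monoʳ-≤ x p)

  -- Reduces an inequality to a ring identity that exhibits the difference as a visibly nonnegative
  -- expression.
  ≤-by : ∀ {x y z} → 0# ≤ z → y - x ≈ z → x ≤ y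
  ≤-by 0≤z eq = 0≤y-x⇒x≤y (≤-trans 0≤z (≤-reflexive (sym eq)))

  +-nonNeg : ∀ {x y} → 0# ≤ x → 0# ≤ y → 0# ≤ x + y
  +-nonNeg p q = ≤-resp₂ (+-identityʳ 0#) refl (+-mono-≤ p q)

  ≤0⇒0≤- : ∀ {x} → x ≤ 0# → 0# ≤ - x
  ≤0⇒0≤- p = ≤-resp₂ refl (+-identityˡ _) (x≤y⇒0≤y-x p)

  *-nonPos : ∀ {x y} → x ≤ 0# → y ≤ 0# → 0# ≤ x * y
  *-nonPos {x} {y} p q = ≤-resp₂ refl
    (solve 2 (λ x y → :- x :* :- y := x :* y) refl x y) (*-nonNeg (≤0⇒0≤- p) (≤0⇒0≤- q))

  0≤x² : ∀ x → 0# ≤ x * x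
  0≤x² x with total 0# x
  ... | inj₁ p = *-nonNeg p p
  ... | inj₂ p = *-nonPos p p

  0≤1 : 0# ≤ 1#
  0≤1 = ≤-resp₂ refl (*-identityˡ 1#) (0≤x² 1#)

  0<1 : 0# < 1#
  0<1 p = 1#≉0# (antisym p 0≤1)

  *-cancelʳ-≈0 : ∀ {x y} → y ≉ 0# → x * y ≈ 0# → x ≈ 0#
  *-cancelʳ-≈0 {x} {y} y≉0 xy≈0 with inverse y y≉0
  ... | z , yz≈1 = begin
    x            ≈⟨ *-identityʳ x ⟨
    x * 1#       ≈⟨ *-congˡ yz≈1 ⟨
    x * (y * z)  ≈⟨ *-assoc x y z ⟨
    x * y * z    ≈⟨ *-congʳ xy≈0 ⟩
    0# * z       ≈⟨ zeroˡ z ⟩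
    0#           ∎
    where open ≈-Reasoning

  x²≈0⇒x≈0 : ∀ {x} → x * x ≈ 0# → x ≈ 0#
  x²≈0⇒x≈0 {x} p with x ≟ 0#
  ... | yes q = q
  ... | no  q = *-cancelʳ-≈0 q p

  x²≤0⇒x≈0 : ∀ {x} → x * x ≤ 0# → x ≈ 0#
  x²≤0⇒x≈0 {x} p = x²≈0⇒x≈0 (antisym p (0≤x² x))

  0<x⇒x≉0 : ∀ {x} → 0# < x → x ≉ 0#
  0<x⇒x≉0 p q = p (≤-reflexive q)

  0≤x⁻¹ : ∀ {x y} → 0# ≤ x → x * y ≈ 1# → 0# ≤ y
  0≤x⁻¹ {x} {y} 0≤x xy≈1 = ≤-resp₂ refl
    (trans (solve 2 (λ x y → y :* y :* x := y :* (x :* y)) refl x y)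
      (trans (*-congˡ xy≈1) (*-identityʳ y)))
    (*-nonNeg (0≤x² y) 0≤x)

  *-monoʳ-≤ : ∀ {x y} z → 0# ≤ z → x ≤ y → x * z ≤ y * z
  *-monoʳ-≤ {x} {y} z 0≤z x≤y = ≤-by (*-nonNeg (x≤y⇒0≤y-x x≤y) 0≤z)
    (solve 3 (λ x y z → y :* z :- x :* z := (y :- x) :* z) refl x y z)

  *-cancelʳ-≤ : ∀ {x y z} → 0# < z → x * z ≤ y * z → x ≤ y
  *-cancelʳ-≤ {x} {y} {z} 0<z xz≤yz with inverse z (0<x⇒x≉0 0<z)
  ... | w , zw≈1 = ≤-resp₂ (lemma x) (lemma y) (*-monoʳ-≤ w (0≤x⁻¹ (<⇒≤ 0<z) zw≈1) xz≤yz)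
    where
    lemma : ∀ x → x * z * w ≈ x
    lemma x = trans (*-assoc x z w) (trans (*-congˡ zw≈1) (*-identityʳ x))

  sum-mono : ∀ {n} {f g : Vector Carrier n} → (∀ i → f i ≤ g i) → sum f ≤ sum g
  sum-mono {zero}  p = ≤-refl
  sum-mono {suc n} p = +-mono-≤ (p zero) (sum-mono (p ∘ suc))

  sum-zero : ∀ {n} {f : Vector Carrier n} → (∀ i → f i ≈ 0#) → sum f ≈ 0#
  sum-zero {n} p = trans (sum-cong-≋ p) (sum-replicate-zero n)

  sum-nonNeg : ∀ {n} {f : Vector Carrier n} → (∀ i → 0# ≤ f i) → 0# ≤ sum f
  sum-nonNeg {n} p = ≤-resp₂ (sum-zero {n} {λ _ → 0#} λ _ → refl) refl (sum-mono p)

  term≤sum : ∀ {n} {f : Vector Carrier n} → (∀ i → 0# ≤ f i) → ∀ i → f i ≤ sum f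
  term≤sum {suc n} {f} p i = ≤-resp₂ (+-identityʳ _) (sym (sum-remove f))
    (+-monoʳ-≤ (f i) (sum-nonNeg (p ∘ punchIn i)))

  -- Gaussian elimination on the first row. A zero row is dropped. Otherwise a nonzero entry serves
  -- as pivot: its unknown is eliminated from the other rows, the smaller system is solved, and `cₚ`
  -- is recovered from the first equation.
  nontrivialSolution : ∀ {m n} → m ℕ.< n → (M : Fin m → Fin n → Carrier) →
    ∃ λ (c : Vector Carrier n) → (∃ λ j → c j ≉ 0#) × (∀ i → sum (λ j → M i j * c j) ≈ 0#)
  nontrivialSolution {zero}  {suc n} _ M = (λ _ → 1#) , (zero , 1#≉0#) , λ ()
  nontrivialSolution {suc m} {suc n} m<n M with Fin.all? (λ j → M zero j ≟ 0#)
  ... | yes row≈0 = let c , c≉0 , eqs = nontrivialSolution (ℕ.<-trans (ℕ.n<1+n m) m<n) (M ∘ suc) in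
    c , c≉0 , λ where
      zero    → sum-zero λ j → trans (*-congʳ (row≈0 j)) (zeroˡ (c j))
      (suc i) → eqs i
  ... | no row≉0 = c , (punchIn p j , ≡.subst (_≉ 0#) (≡.sym (c-punchIn j)) c′j≉0) , eqs
    where
    open ≈-Reasoning
    pivot = Fin.¬∀⟶∃¬ (suc n) _ (λ j → M zero j ≟ 0#) row≉0
    p = proj₁ pivot
    u = proj₁ (inverse (M zero p) (proj₂ pivot))
    pu≈1 = proj₂ (inverse (M zero p) (proj₂ pivot))
    M′ : Fin m → Fin n → Carrier
    -- Row `suc i` minus the multiple of the pivot row that clears column `p`.
    M′ i l = M (suc i) (punchIn p l) - M (suc i) p * u * M zero (punchIn p l)
    sol = nontrivialSolution (ℕ.s<s⁻¹ m<n) M′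
    c′ = proj₁ sol
    j = proj₁ (proj₁ (proj₂ sol))
    c′j≉0 = proj₂ (proj₁ (proj₂ sol))
    T : Fin (suc m) → Carrier
    T i = sum (λ l → M i (punchIn p l) * c′ l)
    cₚ = - (u * T zero)
    c = insertAt c′ p cₚ
    c-punchIn : ∀ l → c (punchIn p l) ≡ c′ l
    c-punchIn = insertAt-punchIn c′ p cₚ
    expand : ∀ i → sum (λ j → M i j * c j) ≈ M i p * cₚ + T i
    expand i = trans (sum-remove {i = p} (λ j → M i j * c j))
      (+-cong (*-congˡ (reflexive (insertAt-lookup c′ p cₚ)))
              (sum-cong-≋ λ l → *-congˡ (reflexive (c-punchIn l))))
    T′ : ∀ i → sum (λ l → M′ i l * c′ l) ≈ T (suc i) - M (suc i) p * u * T zero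
    T′ i = begin
      sum (λ l → M′ i l * c′ l)
        ≈⟨ sum-cong-≋ (λ l → solve 4 (λ a b d c → (a :- b :* d) :* c := a :* c :+ :- b :* (d :* c)) refl
             (M (suc i) (punchIn p l)) (M (suc i) p * u) (M zero (punchIn p l)) (c′ l)) ⟩
      sum (λ l → M (suc i) (punchIn p l) * c′ l + - (M (suc i) p * u) * (M zero (punchIn p l) * c′ l))
        ≈⟨ ∑-distrib-+ (λ l → M (suc i) (punchIn p l) * c′ l) _ ⟩
      T (suc i) + sum (λ l → - (M (suc i) p * u) * (M zero (punchIn p l) * c′ l))
        ≈⟨ +-congˡ (*-distribˡ-sum _ (λ l → M zero (punchIn p l) * c′ l)) ⟨
      T (suc i) + - (M (suc i) p * u) * T zero
        ≈⟨ +-congˡ (-‿distribˡ-* _ _) ⟨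
      T (suc i) - M (suc i) p * u * T zero ∎
    eqs : ∀ i → sum (λ j → M i j * c j) ≈ 0#
    eqs zero    = begin
      sum (λ j → M zero j * c j)            ≈⟨ expand zero ⟩
      M zero p * - (u * T zero) + T zero    ≈⟨ solve 3 (λ a u t → a :* :- (u :* t) :+ t := (con (+ 1) :- a :* u) :* t) refl (M zero p) u (T zero) ⟩
      -- The solver reads `con (+ 1)` as `fromℕ 1`, which unfolds to `1# + 0#`.
      (1# + 0# - M zero p * u) * T zero     ≈⟨ *-congʳ (+-cong (+-identityʳ 1#) (-‿cong pu≈1)) ⟩
      (1# - 1#) * T zero                    ≈⟨ *-congʳ (-‿inverseʳ 1#) ⟩
      0# * T zero                           ≈⟨ zeroˡ _ ⟩
      0#                                    ∎
    eqs (suc i) = begin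
      sum (λ j → M (suc i) j * c j)                  ≈⟨ expand (suc i) ⟩
      M (suc i) p * - (u * T zero) + T (suc i)       ≈⟨ solve 4 (λ a u t s → a :* :- (u :* t) :+ s := s :- a :* u :* t) refl (M (suc i) p) u (T zero) (T (suc i)) ⟩
      T (suc i) - M (suc i) p * u * T zero           ≈⟨ T′ i ⟨
      sum (λ l → M′ i l * c′ l)                      ≈⟨ proj₂ (proj₂ sol) i ⟩
      0#                                             ∎

-- Finiteness replaces excluded middle here: asking for a preimage of each basis vector in turn
-- either uncovers a linear dependence or succeeds throughout.
sum-choice : ∀ {n} {P : Set} {Q : Fin n → Set} → (∀ i → P ⊎ Q i) → P ⊎ (∀ i → Q i)
sum-choice {zero}  f = inj₂ λ ()
sum-choice {suc n} f with f zero | sum-choice (f ∘ suc)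
... | inj₁ p | _      = inj₁ p
... | inj₂ _ | inj₁ p = inj₁ p
... | inj₂ q | inj₂ g = inj₂ λ where
  zero    → q
  (suc i) → g i

-- Inner products, spanning families and orthogonal complements

module LinearAlgebra (ℝ : RealNumbers) where
  open OrderedField ℝ
  open ≈-Reasoning

  Matrix : ℕ → Set
  Matrix n = Fin n → Fin n → Carrier

  infix 8 _∙_
  _∙_ : ∀ {n} → Vector Carrier n → Vector Carrier n → Carrier
  x ∙ y = sum λ i → x i * y i

  infix 9 _·_
  _·_ : ∀ {n} → Matrix n → Vector Carrier n → Vector Carrier n
  (A · x) i = A i ∙ x

  infix 4 _≋_
  _≋_ : ∀ {n} → Vector Carrier n → Vector Carrier n → Set
  x ≋ y = ∀ i → x i ≈ y i

  combination : ∀ {m n} → Vector Carrier m → (Fin m → Vector Carrier n) → Vector Carrier n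
  combination c v i = sum λ j → c j * v j i

  Symmetric : ∀ {n} → Matrix n → Set
  Symmetric A = ∀ i j → A i j ≈ A j i

  δ : ∀ {n} → Matrix n
  δ i j = if does (i Fin.≟ j) then 1# else 0#

  δ-diagonal : ∀ {n} (i : Fin n) → δ i i ≈ 1#
  δ-diagonal i rewrite dec-true (i Fin.≟ i) ≡.refl = refl

  δ-offDiagonal : ∀ {n} {i j : Fin n} → i ≢ j → δ i j ≈ 0#
  δ-offDiagonal {i = i} {j} i≢j rewrite dec-false (i Fin.≟ j) i≢j = refl

  δ-sym : ∀ {n} → Symmetric (δ {n})
  δ-sym i j with i Fin.≟ j
  ... | yes ≡.refl = sym (δ-diagonal i)
  ... | no i≢j     = sym (δ-offDiagonal (i≢j ∘ ≡.sym))

  sum-single : ∀ {n} {f : Vector Carrier n} i → (∀ j → j ≢ i → f j ≈ 0#) → sum f ≈ f i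
  sum-single {suc n} {f} i off = begin
    sum f                              ≈⟨ sum-remove {i = i} f ⟩
    f i + sum (λ j → f (punchIn i j))  ≈⟨ +-congˡ (sum-zero λ j → off _ (Fin.punchInᵢ≢i i j)) ⟩
    f i + 0#                           ≈⟨ +-identityʳ _ ⟩
    f i                                ∎

  δ-∙ : ∀ {n} i (x : Vector Carrier n) → δ i ∙ x ≈ x i
  δ-∙ i x = begin
    δ i ∙ x     ≈⟨ sum-single i (λ j j≢i → trans (*-congʳ (δ-offDiagonal (j≢i ∘ ≡.sym))) (zeroˡ _)) ⟩
    δ i i * x i ≈⟨ *-congʳ (δ-diagonal i) ⟩
    1# * x i    ≈⟨ *-identityˡ _ ⟩
    x i         ∎

  ∙-comm : ∀ {n} (x y : Vector Carrier n) → x ∙ y ≈ y ∙ x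
  ∙-comm x y = sum-cong-≋ λ i → *-comm (x i) (y i)

  ∙-congˡ : ∀ {n} {x y z : Vector Carrier n} → y ≋ z → x ∙ y ≈ x ∙ z
  ∙-congˡ p = sum-cong-≋ λ i → *-congˡ (p i)

  ∙-congʳ : ∀ {n} {x y z : Vector Carrier n} → y ≋ z → y ∙ x ≈ z ∙ x
  ∙-congʳ p = sum-cong-≋ λ i → *-congʳ (p i)

  ∙-zeroʳ : ∀ {n} (x : Vector Carrier n) {y} → y ≋ (λ _ → 0#) → x ∙ y ≈ 0#
  ∙-zeroʳ x p = sum-zero λ i → trans (*-congˡ (p i)) (zeroʳ _)

  ∙-linearʳ : ∀ {n} (x : Vector Carrier n) s t y z →
    x ∙ (λ i → s * y i + t * z i) ≈ s * (x ∙ y) + t * (x ∙ z)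
  ∙-linearʳ {n} x s t y z = begin
    x ∙ (λ i → s * y i + t * z i)
      ≈⟨ sum-cong-≋ (λ i → solve 5 (λ x s t y z → x :* (s :* y :+ t :* z) := s :* (x :* y) :+ t :* (x :* z)) refl (x i) s t (y i) (z i)) ⟩
    sum (λ i → s * (x i * y i) + t * (x i * z i))
      ≈⟨ ∑-distrib-+ (λ i → s * (x i * y i)) _ ⟩
    sum (λ i → s * (x i * y i)) + sum (λ i → t * (x i * z i))
      ≈⟨ +-cong (*-distribˡ-sum {n} s _) (*-distribˡ-sum {n} t _) ⟨
    s * (x ∙ y) + t * (x ∙ z) ∎

  ∙-scaleʳ : ∀ {n} (x : Vector Carrier n) s y → x ∙ (λ i → s * y i) ≈ s * (x ∙ y)
  ∙-scaleʳ {n} x s y = begin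
    x ∙ (λ i → s * y i)           ≈⟨ sum-cong-≋ (λ i → solve 3 (λ x s y → x :* (s :* y) := s :* (x :* y)) refl (x i) s (y i)) ⟩
    sum (λ i → s * (x i * y i))   ≈⟨ *-distribˡ-sum {n} s _ ⟨
    s * (x ∙ y)                   ∎

  ∙-+ʳ : ∀ {n} (x y z : Vector Carrier n) → x ∙ (λ i → y i + z i) ≈ x ∙ y + x ∙ z
  ∙-+ʳ {n} x y z = trans (sum-cong-≋ λ i → distribˡ (x i) (y i) (z i)) (∑-distrib-+ (λ i → x i * y i) _)

  ∙-combination : ∀ {m n} (x : Vector Carrier n) c (v : Fin m → Vector Carrier n) →
    x ∙ combination c v ≈ c ∙ (λ j → x ∙ v j)
  ∙-combination {m} {n} x c v = begin
    sum (λ i → x i * sum (λ j → c j * v j i))    ≈⟨ sum-cong-≋ (λ i → *-distribˡ-sum {m} (x i) _) ⟩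
    sum (λ i → sum λ j → x i * (c j * v j i))    ≈⟨ ∑-comm {n} {m} _ ⟩
    sum (λ j → sum λ i → x i * (c j * v j i))    ≈⟨ sum-cong-≋ (λ j → ∙-scaleʳ x (c j) (v j)) ⟩
    sum (λ j → c j * (x ∙ v j))                  ∎

  combination-∙ : ∀ {m n} c (v : Fin m → Vector Carrier n) x →
    combination c v ∙ x ≈ c ∙ (λ j → v j ∙ x)
  combination-∙ c v x = trans (∙-comm _ x) (trans (∙-combination x c v) (∙-congˡ {x = c} λ j → ∙-comm x (v j)))

  combination-δ : ∀ {n} (c : Vector Carrier n) → combination c δ ≋ c
  combination-δ {n} c i = trans (sum-cong-≋ {n} λ j → trans (*-comm _ _) (*-congʳ (δ-sym j i))) (δ-∙ i c)

  selfAdjoint : ∀ {n} {A : Matrix n} → Symmetric A → ∀ x y → x ∙ (A · y) ≈ (A · x) ∙ y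
  selfAdjoint {n} {A} A-sym x y = begin
    sum (λ i → x i * sum (λ j → A i j * y j))    ≈⟨ sum-cong-≋ (λ i → *-distribˡ-sum {n} (x i) _) ⟩
    sum (λ i → sum λ j → x i * (A i j * y j))    ≈⟨ ∑-comm {n} {n} _ ⟩
    sum (λ j → sum λ i → x i * (A i j * y j))    ≈⟨ sum-cong-≋ (λ j → sum-cong-≋ λ i →
                                                      trans (*-congˡ (*-congʳ (A-sym i j)))
                                                        (solve 3 (λ x a y → x :* (a :* y) := (a :* x) :* y) refl (x i) (A j i) (y j))) ⟩
    sum (λ j → sum λ i → (A j i * x i) * y j)    ≈⟨ sum-cong-≋ (λ j → *-distribʳ-sum {n} (y j) _) ⟨
    sum (λ j → sum (λ i → A j i * x i) * y j)    ∎

  0≤x∙x : ∀ {n} (x : Vector Carrier n) → 0# ≤ x ∙ x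
  0≤x∙x x = sum-nonNeg λ i → 0≤x² (x i)

  xᵢ²≤x∙x : ∀ {n} (x : Vector Carrier n) i → x i * x i ≤ x ∙ x
  xᵢ²≤x∙x x = term≤sum λ i → 0≤x² (x i)

  x∙x≤0⇒x≋0 : ∀ {n} {x : Vector Carrier n} → x ∙ x ≤ 0# → x ≋ (λ _ → 0#)
  x∙x≤0⇒x≋0 {x = x} p i = x²≤0⇒x≈0 (≤-trans (xᵢ²≤x∙x x i) p)

  xᵢ≉0⇒0<x∙x : ∀ {n} {x : Vector Carrier n} {i} → x i ≉ 0# → 0# < x ∙ x
  xᵢ≉0⇒0<x∙x {i = i} xᵢ≉0 p = xᵢ≉0 (x∙x≤0⇒x≋0 p i)

  -- Together with `x` these are n + 1 vectors in an n-dimensional space, so they satisfy a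
  -- nontrivial relation. If the coefficient of `x` vanishes, it is a relation among the `g j`;
  -- otherwise it can be solved for `x`.
  dependent⊎spanning : ∀ {n} (g : Fin n → Vector Carrier n) (x : Vector Carrier n) →
    (∃ λ c → (∃ λ j → c j ≉ 0#) × (combination c g ≋ λ _ → 0#)) ⊎
    (∃ λ c → x ≋ combination c g)
  dependent⊎spanning {n} g x with nontrivialSolution (ℕ.n<1+n n) (λ i j → column j i)
    where
    column : Fin (suc n) → Vector Carrier n
    column zero    = x
    column (suc j) = g j
  ... | c , (j₀ , cj₀≉0) , eqs with c zero ≟ 0#
  ... | yes c₀≈0 = inj₁ (c ∘ suc , nonzero j₀ cj₀≉0 , λ i → begin
    combination (c ∘ suc) g i             ≈⟨ sum-cong-≋ (λ j → *-comm (c (suc j)) (g j i)) ⟩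
    sum (λ j → g j i * c (suc j))         ≈⟨ +-identityˡ _ ⟨
    0# + sum (λ j → g j i * c (suc j))    ≈⟨ +-congʳ (trans (*-congˡ c₀≈0) (zeroʳ (x i))) ⟨
    x i * c zero + sum (λ j → g j i * c (suc j)) ≈⟨ eqs i ⟩
    0#                                    ∎)
    where
    nonzero : ∀ j → c j ≉ 0# → ∃ λ j → c (suc j) ≉ 0#
    nonzero zero    p = contradiction c₀≈0 p
    nonzero (suc j) p = j , p
  ... | no c₀≉0 = inj₂ ((λ j → - u * c (suc j)) , λ i → begin
    x i
      ≈⟨ *-identityʳ _ ⟨
    x i * 1#
      ≈⟨ *-congˡ c₀u≈1 ⟨
    x i * (c zero * u)
      ≈⟨ solve 4 (λ x c u s → x :* (c :* u) := (x :* c :+ s) :* u :+ :- u :* s) refl (x i) (c zero) u (S i) ⟩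
    (x i * c zero + S i) * u + - u * S i
      ≈⟨ +-congʳ (trans (*-congʳ (eqs i)) (zeroˡ u)) ⟩
    0# + - u * S i
      ≈⟨ +-identityˡ _ ⟩
    - u * S i
      ≈⟨ *-distribˡ-sum {n} (- u) _ ⟩
    sum (λ j → - u * (g j i * c (suc j)))
      ≈⟨ sum-cong-≋ (λ j → solve 3 (λ u g c → u :* (g :* c) := u :* c :* g) refl (- u) (g j i) (c (suc j))) ⟩
    sum (λ j → - u * c (suc j) * g j i) ∎)
    where
    u = proj₁ (inverse (c zero) c₀≉0)
    c₀u≈1 = proj₂ (inverse (c zero) c₀≉0)
    S : Vector Carrier n
    S i = sum (λ j → g j i * c (suc j))

  infix 4 _⊥_
  _⊥_ : ∀ {k n} → Vector Carrier n → (Fin k → Vector Carrier n) → Set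
  x ⊥ w = ∀ i → x ∙ w i ≈ 0#

  ⊥-resp-≋ : ∀ {k n} {w : Fin k → Vector Carrier n} {x y} → x ≋ y → x ⊥ w → y ⊥ w
  ⊥-resp-≋ x≋y x⊥w i = trans (sym (∙-congʳ x≋y)) (x⊥w i)

  ⊥-linear : ∀ {k n} {w : Fin k → Vector Carrier n} s t {x y} → x ⊥ w → y ⊥ w →
    (λ i → s * x i + t * y i) ⊥ w
  ⊥-linear {w = w} s t {x} {y} x⊥w y⊥w i = begin
    (λ i → s * x i + t * y i) ∙ w i     ≈⟨ ∙-comm _ (w i) ⟩
    w i ∙ (λ i → s * x i + t * y i)     ≈⟨ ∙-linearʳ (w i) s t x y ⟩
    s * (w i ∙ x) + t * (w i ∙ y)       ≈⟨ +-cong (*-congˡ (trans (∙-comm _ x) (x⊥w i))) (*-congˡ (trans (∙-comm _ y) (y⊥w i))) ⟩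
    s * 0# + t * 0#                     ≈⟨ +-cong (zeroʳ s) (zeroʳ t) ⟩
    0# + 0#                             ≈⟨ +-identityʳ 0# ⟩
    0#                                  ∎

  ⊥-combination : ∀ {k m n} {w : Fin k → Vector Carrier n} c (v : Fin m → Vector Carrier n) →
    (∀ j → v j ⊥ w) → combination c v ⊥ w
  ⊥-combination {w = w} c v v⊥w i = trans (combination-∙ c v (w i)) (∙-zeroʳ c λ j → v⊥w j i)

  -- AM-GM without division by 2
  xy≤x²+y² : ∀ x y → x * y ≤ x * x + y * y
  xy≤x²+y² x y with total 0# (x * y)
  ... | inj₁ p = ≤-by (+-nonNeg (0≤x² (x - y)) p)
    (solve 2 (λ x y → x :* x :+ y :* y :- x :* y := (x :- y) :* (x :- y) :+ x :* y) refl x y)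
  ... | inj₂ p = ≤-by (+-nonNeg (+-nonNeg (0≤x² x) (0≤x² y)) (≤0⇒0≤- p)) refl

  -- Entry by entry, `(a * x i) * x j` is at most `a² * (x i)² + (x j)²`, hence at most
  -- `(a² + 1) * (x ∙ x)`. A crude constant suffices, as it only has to make the set of Rayleigh
  -- quotients bounded.
  rayleighBound : ∀ {n} (A : Matrix n) → ∃ λ C → ∀ x → x ∙ (A · x) ≤ C * (x ∙ x)
  rayleighBound {n} A = sum (λ i → sum λ j → C i j) , λ x →
    ≤-resp₂ (sum-cong-≋ λ i → sym (*-distribˡ-sum {n} (x i) _))
            (trans (sum-cong-≋ λ i → sym (*-distribʳ-sum (x ∙ x) (C i))) (sym (*-distribʳ-sum (x ∙ x) (λ i → sum (C i)))))
            (sum-mono λ i → sum-mono λ j → termBound x i j)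
    where
    C : Matrix n
    C i j = A i j * A i j + 1#
    termBound : ∀ x i j → x i * (A i j * x j) ≤ C i j * (x ∙ x)
    termBound x i j = ≤-by
      (+-nonNeg (+-nonNeg (*-nonNeg (0≤x² a) (x≤y⇒0≤y-x (xᵢ²≤x∙x x i))) (x≤y⇒0≤y-x (xᵢ²≤x∙x x j)))
                (x≤y⇒0≤y-x (xy≤x²+y² (a * x i) (x j))))
      (trans (+-congʳ (*-congʳ (+-congˡ (sym (+-identityʳ 1#)))))
        (solve 4 (λ a x y N → (a :* a :+ con (+ 1)) :* N :- x :* (a :* y) :=
          a :* a :* (N :- x :* x) :+ (N :- y :* y) :+ ((a :* x) :* (a :* x) :+ y :* y :- (a :* x) :* y))
          refl a (x i) (x j) (x ∙ x)))
      where a = A i j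

-- A top eigenvector on an invariant orthogonal complement

module SpectralTheorem (ℝ : RealNumbers) where
  open OrderedField ℝ
  open LinearAlgebra ℝ
  open ≈-Reasoning

  Eigenvector : ∀ {n} → Matrix n → Carrier → Vector Carrier n → Set
  Eigenvector A μ v = A · v ≋ λ i → μ * v i

  -- The projection of `x` to the complement of `w`, given by its result. `across` is characterised
  -- by its orthogonality to that complement and not as a combination of the `w i`, so no
  -- coefficients have to be carried.
  record Splitting {k n} (w : Fin k → Vector Carrier n) (x : Vector Carrier n) : Set where
    field
      along   : Vector Carrier n
      across  : Vector Carrier n
      splits  : x ≋ λ i → along i + across i
      along⊥w : along ⊥ w
      across⊥ : ∀ {y} → y ⊥ w → y ∙ across ≈ 0#
  open Splitting

  module _ {n} (A : Matrix n) (μ : Carrier) where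
    shifted : Matrix n
    shifted i j = μ * δ i j - A i j

    shifted-· : ∀ x → shifted · x ≋ λ i → μ * x i - (A · x) i
    shifted-· x i = begin
      shifted i ∙ x                                ≈⟨ ∙-comm (shifted i) x ⟩
      x ∙ shifted i                                ≈⟨ ∙-congˡ {x = x} (λ j → +-congˡ (sym (-1*x≈-x (A i j)))) ⟩
      x ∙ (λ j → μ * δ i j + - 1# * A i j)         ≈⟨ ∙-linearʳ x μ (- 1#) (δ i) (A i) ⟩
      μ * (x ∙ δ i) + - 1# * (x ∙ A i)             ≈⟨ +-cong (*-congˡ (trans (∙-comm x (δ i)) (δ-∙ i x))) (trans (-1*x≈-x _) (-‿cong (∙-comm x (A i)))) ⟩
      μ * x i - (A · x) i                          ∎

    shifted-sym : Symmetric A → Symmetric shifted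
    shifted-sym A-sym i j = +-cong (*-congˡ (δ-sym i j)) (-‿cong (A-sym i j))

    ∙-shifted : ∀ x → x ∙ (shifted · x) ≈ μ * (x ∙ x) - x ∙ (A · x)
    ∙-shifted x = begin
      x ∙ (shifted · x)                            ≈⟨ ∙-congˡ {x = x} (λ i → trans (shifted-· x i) (+-congˡ (sym (-1*x≈-x _)))) ⟩
      x ∙ (λ i → μ * x i + - 1# * (A · x) i)       ≈⟨ ∙-linearʳ x μ (- 1#) x (A · x) ⟩
      μ * (x ∙ x) + - 1# * (x ∙ (A · x))           ≈⟨ +-congˡ (-1*x≈-x _) ⟩
      μ * (x ∙ x) - x ∙ (A · x)                    ∎

  record TopEigenvector {k n} (A : Matrix n) (w : Fin k → Vector Carrier n) : Set where
    field
      value       : Carrier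
      vector      : Vector Carrier n
      vector⊥w    : vector ⊥ w
      nonzero     : 0# < vector ∙ vector
      eigenvector : Eigenvector A value vector
      maximal     : ∀ x → x ⊥ w → x ∙ (A · x) ≤ value * (x ∙ x)

  bilinear : ∀ {n} {B : Matrix n} → Symmetric B → ∀ s t x y → let z = λ i → s * x i + t * y i in
    z ∙ (B · z) ≈ s * s * (x ∙ (B · x)) + (s * t + s * t) * (x ∙ (B · y)) + t * t * (y ∙ (B · y))
  bilinear {B = B} B-sym s t x y = begin
    z ∙ (B · z)
      ≈⟨ ∙-congˡ {x = z} (λ i → ∙-linearʳ (B i) s t x y) ⟩
    z ∙ (λ i → s * (B · x) i + t * (B · y) i)
      ≈⟨ ∙-linearʳ z s t (B · x) (B · y) ⟩
    s * (z ∙ (B · x)) + t * (z ∙ (B · y))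
      ≈⟨ +-cong (*-congˡ (expand (B · x))) (*-congˡ (expand (B · y))) ⟩
    s * (s * (x ∙ (B · x)) + t * (y ∙ (B · x))) + t * (s * (x ∙ (B · y)) + t * (y ∙ (B · y)))
      ≈⟨ +-congʳ (*-congˡ (+-congˡ (*-congˡ (trans (selfAdjoint B-sym y x) (∙-comm (B · y) x))))) ⟩
    s * (s * (x ∙ (B · x)) + t * (x ∙ (B · y))) + t * (s * (x ∙ (B · y)) + t * (y ∙ (B · y)))
      ≈⟨ solve 5 (λ s t a b c → s :* (s :* a :+ t :* b) :+ t :* (s :* b :+ t :* c) :=
           s :* s :* a :+ (s :* t :+ s :* t) :* b :+ t :* t :* c) refl
           s t (x ∙ (B · x)) (x ∙ (B · y)) (y ∙ (B · y)) ⟩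
    s * s * (x ∙ (B · x)) + (s * t + s * t) * (x ∙ (B · y)) + t * t * (y ∙ (B · y)) ∎
    where
    z = λ i → s * x i + t * y i
    expand : ∀ u → z ∙ u ≈ s * (x ∙ u) + t * (y ∙ u)
    expand u = trans (∙-comm z u) (trans (∙-linearʳ u s t x y)
      (+-cong (*-congˡ (∙-comm u x)) (*-congˡ (∙-comm u y))))

  module _ {k n} (A : Matrix n) (A-sym : Symmetric A) (w : Fin k → Vector Carrier n)
           (invariant : ∀ x → x ⊥ w → A · x ⊥ w) (split : ∀ x → Splitting w x) where

    -- Everything below some Rayleigh quotient on the complement of `w`, written without division.
    -- This downward closure has the same supremum as the quotients themselves.
    IsRayleighLowerBound : Carrier → Set
    IsRayleighLowerBound r = ∃ λ x → x ⊥ w × 0# < x ∙ x × r * (x ∙ x) ≤ x ∙ (A · x)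

    private
      quotient-* : ∀ a {u d} → d * u ≈ 1# → a * u * d ≈ a
      quotient-* a {u} {d} du≈1 = trans (solve 3 (λ a u d → a :* u :* d := a :* (d :* u)) refl a u d)
        (trans (*-congˡ du≈1) (*-identityʳ a))

      attained : ∀ x {u} → x ⊥ w → 0# < x ∙ x → (x ∙ x) * u ≈ 1# → IsRayleighLowerBound (x ∙ (A · x) * u)
      attained x x⊥w 0<xx xxu≈1 = x , x⊥w , 0<xx , ≤-reflexive (quotient-* (x ∙ (A · x)) xxu≈1)

    satisfiable : k ℕ.< n → ∃ IsRayleighLowerBound
    satisfiable k<n =
      let c , (j , cj≉0) , eqs = nontrivialSolution k<n w
          0<cc = xᵢ≉0⇒0<x∙x {x = c} cj≉0
          u , ccu≈1 = inverse (c ∙ c) (0<x⇒x≉0 0<cc)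
      in c ∙ (A · c) * u , attained c (λ i → trans (∙-comm c (w i)) (eqs i)) 0<cc ccu≈1

    bounded : ∀ {r} → IsRayleighLowerBound r → r ≤ proj₁ (rayleighBound A)
    bounded (x , _ , 0<xx , r≤) = *-cancelʳ-≤ 0<xx (≤-trans r≤ (proj₂ (rayleighBound A) x))

    form≤ : ∀ μ → (∀ {r} → IsRayleighLowerBound r → r ≤ μ) → ∀ x → x ⊥ w → x ∙ (A · x) ≤ μ * (x ∙ x)
    form≤ μ upper x x⊥w = case x ∙ x ≤? 0# of λ where
      (yes xx≤0) → ≤-reflexive (trans (trans (∙-comm x _) (∙-zeroʳ (A · x) (x∙x≤0⇒x≋0 xx≤0)))
        (sym (trans (*-congˡ (antisym xx≤0 (0≤x∙x x))) (zeroʳ μ))))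
      (no 0<xx) →
        let u , xxu≈1 = inverse (x ∙ x) (0<x⇒x≉0 0<xx)
        in ≤-resp₂ (quotient-* (x ∙ (A · x)) xxu≈1) refl
             (*-monoʳ-≤ (x ∙ x) (0≤x∙x x) (upper (attained x x⊥w 0<xx xxu≈1)))

    module _ (μ : Carrier) (maximal : ∀ x → x ⊥ w → x ∙ (A · x) ≤ μ * (x ∙ x))
             (least : ∀ ν → (∀ {r} → IsRayleighLowerBound r → r ≤ ν) → μ ≤ ν) where

      private
        B : Matrix n
        B = shifted A μ

        B-psd : ∀ x → x ⊥ w → 0# ≤ x ∙ (B · x)
        B-psd x x⊥w = ≤-resp₂ refl (sym (∙-shifted A μ x)) (x≤y⇒0≤y-x (maximal x x⊥w))

        B-invariant : ∀ x → x ⊥ w → B · x ⊥ w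
        B-invariant x x⊥w = ⊥-resp-≋ {w = w}
          (λ i → sym (trans (shifted-· A μ x i) (+-congˡ (sym (-1*x≈-x _)))))
          (⊥-linear {w = w} μ (- 1#) x⊥w (invariant x x⊥w))

        -- The `g j` are the columns of BP + (1 - P): the operator acts as `B` on the complement of
        -- `w` and as the identity across it.
        p r g : Fin n → Vector Carrier n
        p j = along (split (δ j))
        r j = across (split (δ j))
        g j i = (B · p j) i + r j i

        combination-g : ∀ c → combination c g ≋ λ i → (B · combination c p) i + combination c r i
        combination-g c i = begin
          sum (λ j → c j * ((B · p j) i + r j i))                  ≈⟨ ∙-+ʳ c (λ j → (B · p j) i) (λ j → r j i) ⟩
          sum (λ j → c j * (B · p j) i) + combination c r i        ≈⟨ +-congʳ (∙-combination (B i) c p) ⟨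
          (B · combination c p) i + combination c r i              ∎

        combination-p⊥w : ∀ c → combination c p ⊥ w
        combination-p⊥w c = ⊥-combination {w = w} c p (λ j → along⊥w (split (δ j)))

        ⊥combination-r : ∀ c {y} → y ⊥ w → y ∙ combination c r ≈ 0#
        ⊥combination-r c {y} y⊥w = trans (∙-combination y c r) (∙-zeroʳ c λ j → across⊥ (split (δ j)) y⊥w)

        -- In `B · v + s ≋ 0` the first summand lies in the complement of `w` and `s` is orthogonal
        -- to that complement, so both vanish. Thus `v` is in the kernel of `B`, and it is nonzero
        -- because `c`, being `v + s`, equals `v`.
        topEigenvector-fromKernel : ∀ c {j} → c j ≉ 0# → (combination c g ≋ λ _ → 0#) → TopEigenvector A w
        topEigenvector-fromKernel c {j} cj≉0 eqs = record
          { value       = μ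
          ; vector      = v
          ; vector⊥w    = combination-p⊥w c
          ; nonzero     = xᵢ≉0⇒0<x∙x {x = v} {j} (λ vj≈0 → cj≉0 (trans (c≋v j) vj≈0))
          ; eigenvector = λ i → sym (x-y≈0⇒x≈y (trans (sym (shifted-· A μ v i)) (Bv≋0 i)))
          ; maximal     = maximal
          }
          where
          v = combination c p
          s = combination c r
          Bv+s≋0 : ∀ i → (B · v) i + s i ≈ 0#
          Bv+s≋0 i = trans (sym (combination-g c i)) (eqs i)
          x-y≈0⇒x≈y : ∀ {x y} → x - y ≈ 0# → x ≈ y
          x-y≈0⇒x≈y {x} {y} q = trans (solve 2 (λ x y → x := (x :- y) :+ y) refl x y) (trans (+-congʳ q) (+-identityˡ y))
          Bv⊥s : s ∙ (B · v) ≈ 0#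
          Bv⊥s = trans (∙-comm s _) (⊥combination-r c (B-invariant v (combination-p⊥w c)))
          ss≈0 : s ∙ s ≈ 0#
          ss≈0 = begin
            s ∙ s                          ≈⟨ +-identityˡ _ ⟨
            0# + s ∙ s                     ≈⟨ +-congʳ Bv⊥s ⟨
            s ∙ (B · v) + s ∙ s            ≈⟨ ∙-+ʳ s (B · v) s ⟨
            s ∙ (λ i → (B · v) i + s i)    ≈⟨ ∙-zeroʳ s Bv+s≋0 ⟩
            0#                             ∎
          s≋0 : s ≋ λ _ → 0#
          s≋0 = x∙x≤0⇒x≋0 (≤-reflexive ss≈0)
          Bv≋0 : B · v ≋ λ _ → 0#
          Bv≋0 i = trans (sym (+-identityʳ _)) (trans (+-congˡ (sym (s≋0 i))) (Bv+s≋0 i))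
          c≋v : c ≋ v
          c≋v i = begin
            c i                               ≈⟨ combination-δ c i ⟨
            combination c δ i                 ≈⟨ sum-cong-≋ (λ j → *-congˡ (splits (split (δ j)) i)) ⟩
            sum (λ j → c j * (p j i + r j i)) ≈⟨ ∙-+ʳ c (λ j → p j i) (λ j → r j i) ⟩
            v i + s i                         ≈⟨ +-congˡ (s≋0 i) ⟩
            v i + 0#                          ≈⟨ +-identityʳ _ ⟩
            v i                               ∎

        -- If B is onto, then B ≥ ε > 0 on the complement of w, so that μ - ε is still an upper bound.
        ¬spanning : ¬ (∀ l → ∃ λ c → δ l ≋ combination c g)
        ¬spanning pre = 1#≉0# (trans (sym Dε≈1) (trans (*-congˡ (antisym ε≤0 0≤ε)) (zeroʳ D)))
          where
          y : Fin n → Vector Carrier n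
          y l = combination (proj₁ (pre l)) p
          y⊥w : ∀ l → y l ⊥ w
          y⊥w l = combination-p⊥w (proj₁ (pre l))
          -- The part of the preimage across the complement is invisible to `x`, so `y l` represents
          -- the l-th coordinate with respect to the form of `B`.
          coordinate : ∀ x → x ⊥ w → ∀ l → x ∙ (B · y l) ≈ x l
          coordinate x x⊥w l = sym (begin
            x l                                 ≈⟨ δ-∙ l x ⟨
            δ l ∙ x                             ≈⟨ ∙-comm (δ l) x ⟩
            x ∙ δ l                             ≈⟨ ∙-congˡ {x = x} (proj₂ (pre l)) ⟩
            x ∙ combination c g                 ≈⟨ ∙-congˡ {x = x} (combination-g c) ⟩
            x ∙ (λ i → (B · y l) i + combination c r i)  ≈⟨ ∙-+ʳ x (B · y l) _ ⟩
            x ∙ (B · y l) + x ∙ combination c r ≈⟨ +-congˡ (⊥combination-r c x⊥w) ⟩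
            x ∙ (B · y l) + 0#                  ≈⟨ +-identityʳ _ ⟩
            x ∙ (B · y l)                       ∎)
            where c = proj₁ (pre l)
          β M : Vector Carrier n
          β l = y l ∙ (B · y l)
          M l = β l + 1#
          0≤M : ∀ l → 0# ≤ M l
          0≤M l = +-nonNeg (B-psd (y l) (y⊥w l)) 0≤1
          0<M : ∀ l → 0# < M l
          0<M l M≤0 = 0<1 (≤-trans (≤-by (B-psd (y l) (y⊥w l))
            (solve 2 (λ b o → b :+ o :- o := b) refl (β l) 1#)) M≤0)
          -- Cauchy-Schwarz for `x` and `y l`: the form is nonnegative at `M l * x - x l * y l`. The
          -- exact constant would be `β l`; raising it by 1 makes it positive, so that a factor
          -- `M l` can be cancelled, and costs the extra term `(x l)²`.
          xₗ²≤ : ∀ x → x ⊥ w → ∀ l → x l * x l ≤ M l * (x ∙ (B · x))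
          xₗ²≤ x x⊥w l = *-cancelʳ-≤ (0<M l) (≤-by
            (+-nonNeg (B-psd _ (⊥-linear {w = w} (M l) (- x l) x⊥w (y⊥w l))) (0≤x² (x l)))
            (sym (begin
              _ ≈⟨ +-congʳ (bilinear (shifted-sym A μ A-sym) (M l) (- x l) x (y l)) ⟩
              _ ≈⟨ +-congʳ (+-congʳ (+-congˡ (*-congˡ (coordinate x x⊥w l)))) ⟩
              M l * M l * a + (M l * - x l + M l * - x l) * x l + - x l * - x l * β l + x l * x l
                ≈⟨ solve 5 (λ b o t a m → m :* m :* a :+ (m :* :- t :+ m :* :- t) :* t :+ :- t :* :- t :* b :+ t :* t
                     := m :* a :* m :- t :* t :* m :+ t :* t :* (con (+ 1) :+ b :- m)) refl (β l) 1# (x l) a (M l) ⟩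
              M l * a * M l - x l * x l * M l + x l * x l * (1# + 0# + β l - M l)
                ≈⟨ +-congˡ (trans (*-congˡ (trans (+-congʳ (trans (+-congʳ (+-identityʳ 1#)) (+-comm 1# (β l)))) (-‿inverseʳ (M l)))) (zeroʳ _)) ⟩
              M l * a * M l - x l * x l * M l + 0#   ≈⟨ +-identityʳ _ ⟩
              M l * a * M l - x l * x l * M l        ∎)))
            where a = x ∙ (B · x)
          -- The sum of the coordinate bounds; adding 1 makes it invertible whatever the number of
          -- summands.
          D : Carrier
          D = sum M + 1#
          0≤D : 0# ≤ D
          0≤D = +-nonNeg (sum-nonNeg 0≤M) 0≤1
          D≉0 : D ≉ 0#
          D≉0 D≈0 = 0<1 (≤-trans (≤-by (sum-nonNeg 0≤M) (solve 2 (λ b o → b :+ o :- o := b) refl (sum M) 1#)) (≤-reflexive D≈0))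
          ε : Carrier
          ε = proj₁ (inverse D D≉0)
          Dε≈1 : D * ε ≈ 1#
          Dε≈1 = proj₂ (inverse D D≉0)
          0≤ε : 0# ≤ ε
          0≤ε = 0≤x⁻¹ 0≤D Dε≈1
          xx≤D : ∀ x → x ⊥ w → x ∙ x ≤ D * (x ∙ (B · x))
          xx≤D x x⊥w = ≤-trans (sum-mono (xₗ²≤ x x⊥w)) (≤-by (B-psd x x⊥w) (begin
            D * a - sum (λ l → M l * a)    ≈⟨ +-congˡ (-‿cong (*-distribʳ-sum a M)) ⟨
            D * a - sum M * a              ≈⟨ +-congʳ (trans (distribʳ a (sum M) 1#) (+-congˡ (*-identityˡ a))) ⟩
            sum M * a + a - sum M * a      ≈⟨ solve 2 (λ s a → s :+ a :- s := a) refl (sum M * a) a ⟩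
            a                              ∎))
            where a = x ∙ (B · x)
          upper : ∀ {s} → IsRayleighLowerBound s → s ≤ μ - ε
          upper (x , x⊥w , 0<xx , s≤) = *-cancelʳ-≤ 0<xx (≤-trans s≤
            (≤-by (*-nonNeg 0≤ε (x≤y⇒0≤y-x (xx≤D x x⊥w))) (sym (begin
              ε * (D * a - x ∙ x)                 ≈⟨ solve 4 (λ e d a n → e :* (d :* a :- n) := d :* e :* a :- e :* n) refl ε D a (x ∙ x) ⟩
              D * ε * a - ε * (x ∙ x)             ≈⟨ +-congʳ (trans (*-congʳ Dε≈1) (*-identityˡ a)) ⟩
              a - ε * (x ∙ x)                     ≈⟨ +-congʳ (∙-shifted A μ x) ⟩
              μ * (x ∙ x) - x ∙ (A · x) - ε * (x ∙ x)
                ≈⟨ solve 4 (λ m n b e → m :* n :- b :- e :* n := (m :- e) :* n :- b) refl μ (x ∙ x) (x ∙ (A · x)) ε ⟩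
              (μ - ε) * (x ∙ x) - x ∙ (A · x)     ∎))))
            where a = x ∙ (B · x)
          ε≤0 : ε ≤ 0#
          ε≤0 = ≤-by (x≤y⇒0≤y-x (least (μ - ε) upper))
            (solve 2 (λ m e → con (+ 0) :- e := m :- e :- m) refl μ ε)

      topEigenvector-fromSupremum : TopEigenvector A w
      topEigenvector-fromSupremum with sum-choice (λ l → dependent⊎spanning g (δ l))
      ... | inj₁ (c , (_ , cj≉0) , eqs) = topEigenvector-fromKernel c cj≉0 eqs
      ... | inj₂ pre                    = contradiction pre ¬spanning

    topEigenvector : k ℕ.< n → TopEigenvector A w
    topEigenvector k<n =
      let μ , upper , least = leastUpperBound IsRayleighLowerBound (satisfiable k<n) (_ , bounded)
      in topEigenvector-fromSupremum μ (form≤ μ upper) (λ ν → least)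

-- Orthogonal families and the construction of an eigenbasis

module KyFan (ℝ : RealNumbers) where
  open OrderedField ℝ
  open LinearAlgebra ℝ
  open SpectralTheorem ℝ
  open Spectral ℝ using (LinearlyIndependent; partialSum)
  open ≈-Reasoning

  -- Unit vectors would require square roots. Instead `weight j` is the inverse of the squared
  -- length, and it accompanies every product of two coordinates.
  record OrthogonalFamily (d n : ℕ) : Set where
    field
      vector     : Fin d → Vector Carrier n
      weight     : Vector Carrier d
      normalised : ∀ j → weight j * (vector j ∙ vector j) ≈ 1#
      0≤weight   : ∀ j → 0# ≤ weight j
      orthogonal : ∀ {i j} → i ≢ j → vector i ∙ vector j ≈ 0#

    combination-coordinate : ∀ c j → vector j ∙ combination c vector ≈ c j * (vector j ∙ vector j)
    combination-coordinate c j = trans (∙-combination (vector j) c vector)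
      (sum-single j λ i i≢j → trans (*-congˡ (orthogonal (i≢j ∘ ≡.sym))) (zeroʳ (c i)))

    combination-weight : ∀ c j → weight j * (vector j ∙ combination c vector) ≈ c j
    combination-weight c j = begin
      weight j * (vector j ∙ combination c vector)    ≈⟨ *-congˡ (combination-coordinate c j) ⟩
      weight j * (c j * (vector j ∙ vector j))        ≈⟨ solve 3 (λ q c n → q :* (c :* n) := c :* (q :* n)) refl (weight j) (c j) (vector j ∙ vector j) ⟩
      c j * (weight j * (vector j ∙ vector j))        ≈⟨ *-congˡ (normalised j) ⟩
      c j * 1#                                        ≈⟨ *-identityʳ _ ⟩
      c j                                             ∎

    independent : LinearlyIndependent vector
    independent c eqs j = begin
      c j                                             ≈⟨ combination-weight c j ⟨
      weight j * (vector j ∙ combination c vector)    ≈⟨ *-congˡ (∙-zeroʳ (vector j) eqs) ⟩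
      weight j * 0#                                   ≈⟨ zeroʳ _ ⟩
      0#                                              ∎

  module _ {n} (F : OrthogonalFamily n n) where
    open OrthogonalFamily F

    -- Orthogonality makes the n vectors independent, which excludes the dependent case of
    -- `dependent⊎spanning`; the coefficients are then read off by inner products.
    expansion : ∀ x → x ≋ combination (λ j → weight j * (vector j ∙ x)) vector
    expansion x i with dependent⊎spanning vector x
    ... | inj₁ (c , (j , cj≉0) , eqs) = contradiction (independent c eqs j) cj≉0
    ... | inj₂ (c , x≋) = begin
      x i                    ≈⟨ x≋ i ⟩
      combination c vector i ≈⟨ sum-cong-≋ (λ j → *-congʳ {x = vector j i} (coefficient j)) ⟨
      combination (λ j → weight j * (vector j ∙ x)) vector i ∎
      where
      coefficient : ∀ j → weight j * (vector j ∙ x) ≈ c j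
      coefficient j = trans (*-congˡ (∙-congˡ {x = vector j} x≋)) (combination-weight c j)

    parseval : ∀ x y → x ∙ y ≈ sum (λ j → weight j * ((vector j ∙ x) * (vector j ∙ y)))
    parseval x y = begin
      x ∙ y
        ≈⟨ ∙-congˡ {x = x} (expansion y) ⟩
      x ∙ combination (λ j → weight j * (vector j ∙ y)) vector
        ≈⟨ ∙-combination x _ vector ⟩
      sum (λ j → weight j * (vector j ∙ y) * (x ∙ vector j))
        ≈⟨ sum-cong-≋ (λ j → trans (*-congˡ (∙-comm x (vector j)))
             (solve 3 (λ q y x → q :* y :* x := q :* (x :* y)) refl (weight j) (vector j ∙ y) (vector j ∙ x))) ⟩
      sum (λ j → weight j * ((vector j ∙ x) * (vector j ∙ y))) ∎

    -- The trace does not depend on the orthogonal basis: each diagonal entry is the inner product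
    -- of `δ i` with row `i`, to which Parseval applies.
    rayleighSum≈trace : ∀ M → sum (λ j → weight j * (vector j ∙ (M · vector j))) ≈ sum (λ i → M i i)
    rayleighSum≈trace M = begin
      sum (λ j → weight j * (vector j ∙ (M · vector j)))
        ≈⟨ sum-cong-≋ (λ j → *-distribˡ-sum {n} (weight j) _) ⟩
      sum (λ j → sum λ i → weight j * (vector j i * (M i ∙ vector j)))
        ≈⟨ ∑-comm {n} {n} _ ⟩
      sum (λ i → sum λ j → weight j * (vector j i * (M i ∙ vector j)))
        ≈⟨ sum-cong-≋ (λ i → sum-cong-≋ λ j → *-congˡ (*-cong
             (trans (sym (δ-∙ i (vector j))) (∙-comm (δ i) (vector j))) (∙-comm (M i) (vector j)))) ⟩
      sum (λ i → sum λ j → weight j * ((vector j ∙ δ i) * (vector j ∙ M i)))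
        ≈⟨ sum-cong-≋ (λ i → parseval (δ i) (M i)) ⟨
      sum (λ i → δ i ∙ M i)
        ≈⟨ sum-cong-≋ (λ i → δ-∙ i (M i)) ⟩
      sum (λ i → M i i) ∎

  record Eigenframe {k n} (A : Matrix n) (w : Fin k → Vector Carrier n) (d : ℕ) : Set where
    field
      family      : OrthogonalFamily d n
      value       : Vector Carrier d
    open OrthogonalFamily family public
    field
      vector⊥w    : ∀ j → vector j ⊥ w
      eigenvector : ∀ j → Eigenvector A (value j) (vector j)
      decreasing  : ∀ {i j} → i Fin.≤ j → value j ≤ value i

  module _ {n} (A : Matrix n) (A-sym : Symmetric A) where

    eigenvector-∙ : ∀ {μ v} → Eigenvector A μ v → ∀ x → (A · x) ∙ v ≈ μ * (x ∙ v)
    eigenvector-∙ {μ} {v} ev x = begin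
      (A · x) ∙ v              ≈⟨ selfAdjoint A-sym x v ⟨
      x ∙ (A · v)              ≈⟨ ∙-congˡ {x = x} ev ⟩
      x ∙ (λ i → μ * v i)      ≈⟨ ∙-scaleʳ x μ v ⟩
      μ * (x ∙ v)              ∎

    -- Induction on the dimension `d` still to be filled. The complement of `w` is invariant because
    -- the `w i` are eigenvectors of a symmetric matrix, so it has a top eigenvector, which joins
    -- `w`.
    eigenframe : ∀ d {k} (w : Fin k → Vector Carrier n) → k ℕ.+ d ≡ n →
      (∀ i → ∃ λ μ → Eigenvector A μ (w i)) → (∀ x → Splitting w x) → Eigenframe A w d
    eigenframe zero    w k+d≡n w-eigen split = record
      { family = record { vector = λ () ; weight = λ () ; normalised = λ () ; 0≤weight = λ () ; orthogonal = λ {} }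
      ; value = λ () ; vector⊥w = λ () ; eigenvector = λ () ; decreasing = λ {} }
    eigenframe (suc d) {k} w k+d≡n w-eigen split = record
      { family = record
        { vector     = v ∷ rest.vector
        ; weight     = q ∷ rest.weight
        ; normalised = λ { zero → trans (*-comm q _) vvq≈1 ; (suc j) → rest.normalised j }
        ; 0≤weight   = λ { zero → 0≤x⁻¹ (0≤x∙x v) vvq≈1 ; (suc j) → rest.0≤weight j }
        ; orthogonal = λ
          { {zero}  {zero}  i≢j → contradiction ≡.refl i≢j
          ; {zero}  {suc j} i≢j → trans (∙-comm v (rest.vector j)) (rest.vector⊥w j zero)
          ; {suc i} {zero}  i≢j → rest.vector⊥w i zero
          ; {suc i} {suc j} i≢j → rest.orthogonal (i≢j ∘ ≡.cong suc) }
        }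
      ; value       = top.value ∷ rest.value
      ; vector⊥w    = λ { zero → top.vector⊥w ; (suc j) i → rest.vector⊥w j (suc i) }
      ; eigenvector = λ { zero → top.eigenvector ; (suc j) → rest.eigenvector j }
      ; decreasing  = λ
        { {zero}  {zero}  i≤j → ≤-refl
        ; {zero}  {suc j} i≤j → rest≤top j
        ; {suc i} {zero}  ()
        ; {suc i} {suc j} i≤j → rest.decreasing (ℕ.s≤s⁻¹ i≤j) }
      }
      where
      k<n : k ℕ.< n
      k<n = ≡.subst (k ℕ.<_) k+d≡n (≡.subst (k ℕ.<_) (≡.sym (ℕ.+-suc k d)) (ℕ.s≤s (ℕ.m≤m+n k d)))
      invariant : ∀ x → x ⊥ w → A · x ⊥ w
      invariant x x⊥w i = let μ , ev = w-eigen i in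
        trans (eigenvector-∙ ev x) (trans (*-congˡ (x⊥w i)) (zeroʳ μ))
      module top = TopEigenvector (topEigenvector A A-sym w invariant split k<n)
      v = top.vector
      q = proj₁ (inverse (v ∙ v) (0<x⇒x≉0 top.nonzero))
      vvq≈1 = proj₂ (inverse (v ∙ v) (0<x⇒x≉0 top.nonzero))
      -- The component of `p` along `v` moves from one part to the other. The factors `1#` give both
      -- parts the shape that the linearity lemmas expect.
      split′ : ∀ x → Splitting (v ∷ w) x
      split′ x = record
        { along   = λ i → 1# * p i + - s * v i
        ; across  = λ i → 1# * r i + s * v i
        ; splits  = λ i → trans (splits i)
            (trans (sym (+-cong (*-identityˡ (p i)) (*-identityˡ (r i))))
              (solve 4 (λ p r s v → p :+ r := p :+ :- s :* v :+ (r :+ s :* v)) refl (1# * p i) (1# * r i) s (v i)))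
        ; along⊥w = λ
          { zero    → trans (∙-comm _ v) (begin
              v ∙ (λ i → 1# * p i + - s * v i)         ≈⟨ ∙-linearʳ v 1# (- s) p v ⟩
              1# * (v ∙ p) + - (v ∙ p * q) * (v ∙ v)   ≈⟨ +-congʳ (*-identityˡ _) ⟩
              v ∙ p + - (v ∙ p * q) * (v ∙ v)          ≈⟨ solve 3 (λ a q n → a :+ :- (a :* q) :* n := a :+ :- a :* (n :* q)) refl (v ∙ p) q (v ∙ v) ⟩
              v ∙ p + - (v ∙ p) * ((v ∙ v) * q)        ≈⟨ +-congˡ (trans (*-congˡ vvq≈1) (*-identityʳ _)) ⟩
              v ∙ p - v ∙ p                            ≈⟨ -‿inverseʳ _ ⟩
              0#                                       ∎)
          ; (suc i) → ⊥-linear {w = w} 1# (- s) along⊥w top.vector⊥w i }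
        ; across⊥ = λ {y} y⊥ → begin
            y ∙ (λ i → 1# * r i + s * v i)    ≈⟨ ∙-linearʳ y 1# s r v ⟩
            1# * (y ∙ r) + s * (y ∙ v)        ≈⟨ +-cong (*-congˡ (across⊥ (λ i → y⊥ (suc i)))) (*-congˡ (y⊥ zero)) ⟩
            1# * 0# + s * 0#                  ≈⟨ +-cong (zeroʳ 1#) (zeroʳ s) ⟩
            0# + 0#                           ≈⟨ +-identityʳ 0# ⟩
            0#                                ∎
        }
        where
        open Splitting (split x) renaming (along to p; across to r)
        s = v ∙ p * q
      restFrame : Eigenframe A (v ∷ w) d
      restFrame = eigenframe d (v ∷ w) (≡.trans (≡.sym (ℕ.+-suc k d)) k+d≡n)
        (λ { zero → top.value , top.eigenvector ; (suc i) → w-eigen i }) split′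
      module rest = Eigenframe restFrame
      -- The later eigenvectors still lie in the complement of `w`, on which `top.value` bounds the
      -- Rayleigh quotient.
      rest≤top : ∀ j → rest.value j ≤ top.value
      rest≤top j = *-cancelʳ-≤ 0<uu (≤-resp₂ (trans (∙-comm u _) (eigenvector-∙ (rest.eigenvector j) u)) refl
        (top.maximal u (λ i → rest.vector⊥w j (suc i))))
        where
        u = rest.vector j
        0<uu : 0# < u ∙ u
        0<uu uu≤0 = 1#≉0# (trans (sym (rest.normalised j))
          (trans (*-congˡ (antisym uu≤0 (0≤x∙x u))) (zeroʳ (rest.weight j))))

    eigenbasis : Eigenframe {0} A (λ ()) n
    eigenbasis = eigenframe n (λ ()) ≡.refl (λ ()) λ x → record
      { along = x ; across = λ _ → 0# ; splits = λ i → sym (+-identityʳ (x i)) ; along⊥w = λ ()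
      ; across⊥ = λ {y} _ → ∙-zeroʳ y λ _ → refl }

-- Comparison of spectra and Ky Fan's inequality

module Comparison (ℝ : RealNumbers) where
  open OrderedField ℝ
  open LinearAlgebra ℝ
  open SpectralTheorem ℝ
  open KyFan ℝ
  open Spectral ℝ using (LinearlyIndependent; partialSum)
  open ≈-Reasoning

  module _ {n} (A : Matrix n) (A-sym : Symmetric A) where

    distinctEigenvalues⇒⊥ : ∀ {μ v ν u} → Eigenvector A μ v → Eigenvector A ν u → ν < μ → v ∙ u ≈ 0#
    distinctEigenvalues⇒⊥ {μ} {v} {ν} {u} ev eu ν<μ = *-cancelʳ-≈0 (λ μ-ν≈0 → ν<μ (≤-by ≤-refl μ-ν≈0)) (begin
      v ∙ u * (ν - μ)              ≈⟨ solve 3 (λ a m n → a :* (n :- m) := n :* a :- m :* a) refl (v ∙ u) μ ν ⟩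
      ν * (v ∙ u) - μ * (v ∙ u)    ≈⟨ +-cong (sym (eigenvector-∙ A A-sym eu v)) (-‿cong μvu≈) ⟩
      (A · v) ∙ u - (A · v) ∙ u    ≈⟨ -‿inverseʳ _ ⟩
      0#                           ∎)
      where
      μvu≈ : μ * (v ∙ u) ≈ (A · v) ∙ u
      μvu≈ = trans (*-congˡ (∙-comm v u)) (trans (sym (eigenvector-∙ A A-sym ev u))
        (trans (sym (selfAdjoint A-sym u v)) (∙-comm u (A · v))))

  -- Without row `j` there are fewer equations than unknowns. Indexing the rows by all of `Fin n`
  -- lets two kinds of conditions share one square matrix in `eigenvalue≤`.
  solutionExceptAt : ∀ {n} (R : Matrix n) (j : Fin n) →
    ∃ λ (c : Vector Carrier n) → (∃ λ l → c l ≉ 0#) × (∀ i → j ≢ i → R i ∙ c ≈ 0#)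
  solutionExceptAt {suc m} R j with nontrivialSolution (ℕ.n<1+n m) (λ i → R (punchIn j i))
  ... | c , c≉0 , eqs = c , c≉0 , λ i j≢i →
    ≡.subst (λ i → R i ∙ c ≈ 0#) (Fin.punchIn-punchOut j≢i) (eqs (Fin.punchOut j≢i))

  -- If the j-th eigenvalue exceeded that of the orthogonal basis, then v 0, …, v j would have a nontrivial
  -- combination orthogonal to the whole basis: its inner products with the first j basis vectors are
  -- j linear conditions on j + 1 coefficients, those with the other ones vanish automatically.
  eigenvalue≤ : ∀ {n} (A : Matrix n) (A-sym : Symmetric A) (F : Eigenframe {0} A (λ ()) n)
    {eig : Vector Carrier n} {v : Fin n → Vector Carrier n} → (∀ {i j} → i Fin.≤ j → eig j ≤ eig i) → LinearlyIndependent v → (∀ j → Eigenvector A (eig j) (v j)) →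
    ∀ j → eig j ≤ Eigenframe.value F j
  eigenvalue≤ {n} A A-sym F {eig} {v} eig-dec v-ind v-eig j with eig j ≤? Eigenframe.value F j
  ... | yes eigj≤ = eigj≤
  ... | no value<eig = contradiction (v-ind c c·v≋0 l₀) cl₀≉0
    where
    open Eigenframe F
    -- Rows before `j` demand orthogonality to the corresponding basis vector, rows after `j` demand
    -- that the coefficient vanish, and row `j` itself is the one left out.
    R : Matrix n
    R i l = if does (i Fin.<? j) then vector i ∙ v l else δ i l
    solution = solutionExceptAt R j
    c = proj₁ solution
    l₀ = proj₁ (proj₁ (proj₂ solution))
    cl₀≉0 = proj₂ (proj₁ (proj₂ solution))
    constraint = proj₂ (proj₂ solution)
    x = combination c v
    x⊥ : ∀ i → vector i ∙ x ≈ 0#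
    x⊥ i with i Fin.<? j in eq
    ... | yes i<j = begin
      vector i ∙ x                         ≈⟨ ∙-combination (vector i) c v ⟩
      c ∙ (λ l → vector i ∙ v l)           ≈⟨ ∙-comm c _ ⟩
      (λ l → vector i ∙ v l) ∙ c           ≡⟨ ≡.cong (λ d → (λ l → if does d then vector i ∙ v l else δ i l) ∙ c) eq ⟨
      R i ∙ c                              ≈⟨ constraint i (λ { ≡.refl → ℕ.<-irrefl ≡.refl i<j }) ⟩
      0#                                   ∎
    ... | no i≮j = trans (∙-combination (vector i) c v) (sum-zero term≈0)
      where
      term≈0 : ∀ l → c l * (vector i ∙ v l) ≈ 0#
      term≈0 l with l Fin.≤? j
      -- Here `eig l ≥ eig j > value j ≥ value i`, so the two eigenvectors belong to distinct
      -- eigenvalues.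
      ... | yes l≤j = trans (*-congˡ (trans (∙-comm (vector i) (v l))
          (distinctEigenvalues⇒⊥ A A-sym (v-eig l) (eigenvector i) λ eigl≤ →
            value<eig (≤-trans (eig-dec l≤j) (≤-trans eigl≤ (decreasing (ℕ.≮⇒≥ i≮j)))))))
        (zeroʳ _)
      ... | no l≰j = trans (*-congʳ cl≈0) (zeroˡ _)
        where
        Rl≈δ : ∀ i → R l i ≈ δ l i
        Rl≈δ i rewrite dec-false (l Fin.<? j) (l≰j ∘ ℕ.<⇒≤) = refl
        cl≈0 : c l ≈ 0#
        cl≈0 = begin
          c l       ≈⟨ δ-∙ l c ⟨
          δ l ∙ c   ≈⟨ ∙-congʳ {x = c} Rl≈δ ⟨
          R l ∙ c   ≈⟨ constraint l (λ { ≡.refl → l≰j ℕ.≤-refl }) ⟩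
          0#        ∎
    c·v≋0 : x ≋ λ _ → 0#
    c·v≋0 i = trans (expansion family x i)
      (sum-zero λ j → trans (*-congʳ (trans (*-congˡ (x⊥ j)) (zeroʳ (weight j)))) (zeroˡ _))

  -- An indicator weight turns a partial sum into an inner product over all of `Fin n`, so that
  -- double sums can be exchanged freely.
  initial : ∀ {n} → ℕ → Vector Carrier n
  initial k i = if does (Fin.toℕ i ℕ.<? k) then 1# else 0#

  initial-∙ : ∀ {n} k (k≤n : k ℕ.≤ n) f → initial {n} k ∙ f ≈ partialSum f k k≤n
  initial-∙ zero    k≤n f = sum-zero λ i → zeroˡ (f i)
  initial-∙ {suc n} (suc k) k≤n f = +-cong (*-identityˡ _) (initial-∙ k (ℕ.s≤s⁻¹ k≤n) (f ∘ suc))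

  0≤initial : ∀ {n} k i → 0# ≤ initial {n} k i
  0≤initial k i with does (Fin.toℕ i ℕ.<? k)
  ... | true  = 0≤1
  ... | false = ≤-refl

  initial≤1 : ∀ {n} k i → initial {n} k i ≤ 1#
  initial≤1 k i with does (Fin.toℕ i ℕ.<? k)
  ... | true  = ≤-refl
  ... | false = 0≤1

  -- Subtract `μ = b t`, the last value counted; both sides change by the same amount. Now `b i - μ`
  -- is nonnegative up to `t` and nonpositive beyond, so weighting it with `χ i` gives at least as
  -- much as weighting it with any `χ j` between 0 and 1. Averaging with `c` uses the row sums on
  -- the left and the column sums on the right. Indexing by `t`, with `suc (toℕ t)` terms,
  -- guarantees that the value `b t` exists.
  doublyStochastic-partialSum≤ : ∀ {n} (c : Matrix n) {b : Vector Carrier n} →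
    (∀ j i → 0# ≤ c j i) → (∀ j → sum (c j) ≈ 1#) → (∀ i → sum (λ j → c j i) ≈ 1#) →
    (∀ {i j} → i Fin.≤ j → b j ≤ b i) → ∀ (t : Fin n) → let χ = initial (suc (Fin.toℕ t)) in
    χ ∙ (λ j → c j ∙ b) ≤ χ ∙ b
  doublyStochastic-partialSum≤ {n} c {b} 0≤c rows columns b-dec t =
    ≤-by (x≤y⇒0≤y-x shiftedInequality)
      (solve 3 (λ x y z → y :- x := y :+ z :- (x :+ z)) refl (χ ∙ (λ j → c j ∙ b)) (χ ∙ b) (χ ∙ λ _ → - μ))
    where
    χ = initial (suc (Fin.toℕ t))
    μ = b t
    s : Vector Carrier n
    s j = c j ∙ b
    g : Vector Carrier n
    g i = χ i * (b i - μ)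
    termwise : ∀ j i → χ j * (b i - μ) ≤ g i
    termwise j i with Fin.toℕ i ℕ.<? suc (Fin.toℕ t)
    ... | yes i≤t rewrite dec-true (Fin.toℕ i ℕ.<? suc (Fin.toℕ t)) i≤t = *-monoʳ-≤ (b i - μ) (x≤y⇒0≤y-x (b-dec (ℕ.s≤s⁻¹ i≤t))) (initial≤1 (suc (Fin.toℕ t)) j)
    ... | no  i≰t rewrite dec-false (Fin.toℕ i ℕ.<? suc (Fin.toℕ t)) i≰t = ≤-by (*-nonNeg (0≤initial (suc (Fin.toℕ t)) j) (x≤y⇒0≤y-x (b-dec (ℕ.<⇒≤ (ℕ.≮⇒≥ i≰t)))))
      (solve 3 (λ x b m → con (+ 0) :* (b :- m) :- x :* (b :- m) := x :* (m :- b)) refl (χ j) (b i) μ)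
    row : ∀ j → χ j * (s j - μ) ≈ sum (λ i → c j i * (χ j * (b i - μ)))
    row j = sym (begin
      c j ∙ (λ i → χ j * (b i - μ))              ≈⟨ ∙-scaleʳ (c j) (χ j) _ ⟩
      χ j * (c j ∙ λ i → b i - μ)                ≈⟨ *-congˡ (∙-+ʳ (c j) b (λ _ → - μ)) ⟩
      χ j * (s j + (c j ∙ λ _ → - μ))            ≈⟨ *-congˡ (+-congˡ (*-distribʳ-sum (- μ) (c j))) ⟨
      χ j * (s j + sum (c j) * - μ)              ≈⟨ *-congˡ (+-congˡ (trans (*-congʳ (rows j)) (*-identityˡ _))) ⟩
      χ j * (s j - μ)                            ∎)
    column : sum (λ j → sum λ i → c j i * g i) ≈ sum g
    column = begin
      sum (λ j → sum λ i → c j i * g i)    ≈⟨ ∑-comm {n} {n} _ ⟩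
      sum (λ i → sum λ j → c j i * g i)    ≈⟨ sum-cong-≋ (λ i → *-distribʳ-sum (g i) (λ j → c j i)) ⟨
      sum (λ i → sum (λ j → c j i) * g i)  ≈⟨ sum-cong-≋ (λ i → trans (*-congʳ (columns i)) (*-identityˡ _)) ⟩
      sum g                                ∎
    shiftedInequality : χ ∙ s + (χ ∙ λ _ → - μ) ≤ χ ∙ b + (χ ∙ λ _ → - μ)
    shiftedInequality = ≤-resp₂
      (trans (sym (sum-cong-≋ row)) (∙-+ʳ χ s (λ _ → - μ)))
      (trans column (∙-+ʳ χ b (λ _ → - μ)))
      (sum-mono λ j → sum-mono λ i → ≤-resp₂ (*-comm _ _) (*-comm _ _) (*-monoʳ-≤ (c j i) (0≤c j i) (termwise j i)))

  -- The Rayleigh quotients of `W` are averages of the eigenvalues, with the squared cosines between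
  -- the two families as weights. By Parseval in either family these form a doubly stochastic
  -- matrix.
  kyFan : ∀ {n} (A : Matrix n) (A-sym : Symmetric A) (U : Eigenframe {0} A (λ ()) n)
    (W : OrthogonalFamily n n) (t : Fin n) →
    let χ = initial (suc (Fin.toℕ t))
        open OrthogonalFamily W
    in χ ∙ (λ j → weight j * (vector j ∙ (A · vector j))) ≤ χ ∙ Eigenframe.value U
  kyFan {n} A A-sym U W t = ≤-trans
    (≤-reflexive (∙-congˡ {x = initial (suc (Fin.toℕ t))} rayleigh))
    (doublyStochastic-partialSum≤ c {U.value} 0≤c rows columns U.decreasing t)
    where
    module U = Eigenframe U
    module W = OrthogonalFamily W
    γ : Matrix n
    γ j i = U.vector i ∙ W.vector j
    c : Matrix n
    c j i = W.weight j * (U.weight i * (γ j i * γ j i))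
    0≤c : ∀ j i → 0# ≤ c j i
    0≤c j i = *-nonNeg (W.0≤weight j) (*-nonNeg (U.0≤weight i) (0≤x² (γ j i)))
    rows : ∀ j → sum (c j) ≈ 1#
    rows j = begin
      sum (c j)                                                  ≈⟨ *-distribˡ-sum (W.weight j) (λ i → U.weight i * (γ j i * γ j i)) ⟨
      W.weight j * sum (λ i → U.weight i * (γ j i * γ j i))      ≈⟨ *-congˡ (parseval U.family (W.vector j) (W.vector j)) ⟨
      W.weight j * (W.vector j ∙ W.vector j)                     ≈⟨ W.normalised j ⟩
      1#                                                         ∎
    columns : ∀ i → sum (λ j → c j i) ≈ 1#
    columns i = begin
      sum (λ j → c j i)
        ≈⟨ sum-cong-≋ (λ j → trans (solve 3 (λ q p g → q :* (p :* g) := p :* (q :* g)) refl (W.weight j) (U.weight i) (γ j i * γ j i))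
             (*-congˡ (*-congˡ (*-cong (∙-comm (U.vector i) (W.vector j)) (∙-comm (U.vector i) (W.vector j)))))) ⟩
      sum (λ j → U.weight i * (W.weight j * ((W.vector j ∙ U.vector i) * (W.vector j ∙ U.vector i))))
        ≈⟨ *-distribˡ-sum {n} (U.weight i) _ ⟨
      U.weight i * sum (λ j → W.weight j * ((W.vector j ∙ U.vector i) * (W.vector j ∙ U.vector i)))
        ≈⟨ *-congˡ (parseval W (U.vector i) (U.vector i)) ⟨
      U.weight i * (U.vector i ∙ U.vector i)
        ≈⟨ U.normalised i ⟩
      1# ∎
    rayleigh : ∀ j → W.weight j * (W.vector j ∙ (A · W.vector j)) ≈ c j ∙ U.value
    rayleigh j = begin
      W.weight j * (W.vector j ∙ (A · W.vector j))
        ≈⟨ *-congˡ (parseval U.family (W.vector j) (A · W.vector j)) ⟩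
      W.weight j * sum (λ i → U.weight i * (γ j i * (U.vector i ∙ (A · W.vector j))))
        ≈⟨ *-distribˡ-sum {n} (W.weight j) _ ⟩
      sum (λ i → W.weight j * (U.weight i * (γ j i * (U.vector i ∙ (A · W.vector j)))))
        ≈⟨ sum-cong-≋ (λ i → *-congˡ (*-congˡ (*-congˡ (trans (∙-comm (U.vector i) _)
             (trans (eigenvector-∙ A A-sym (U.eigenvector i) (W.vector j)) (*-congˡ (∙-comm (W.vector j) (U.vector i)))))))) ⟩
      sum (λ i → W.weight j * (U.weight i * (γ j i * (U.value i * γ j i))))
        ≈⟨ sum-cong-≋ (λ i → solve 4 (λ q p g b → q :* (p :* (g :* (b :* g))) := q :* (p :* (g :* g)) :* b) refl
             (W.weight j) (U.weight i) (γ j i) (U.value i)) ⟩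
      c j ∙ U.value ∎

  -- Each eigenvalue of `A` is the Rayleigh quotient of its eigenvector, hence the sum of those of
  -- `A₀` and `M`. Ky Fan bounds the first kind; the second kind is nonnegative, so its partial sum
  -- is at most the full sum, the trace.
  partialSum≤partialSum+trace : ∀ {n} (A A₀ M : Matrix n) → Symmetric A → (A₀-sym : Symmetric A₀) →
    (∀ x → 0# ≤ x ∙ (M · x)) → (∀ i j → A i j ≈ A₀ i j + M i j) →
    (F : Eigenframe {0} A (λ ()) n) (F₀ : Eigenframe {0} A₀ (λ ()) n) (t : Fin n) →
    let χ = initial (suc (Fin.toℕ t)) in
    χ ∙ Eigenframe.value F ≤ χ ∙ Eigenframe.value F₀ + sum (λ i → M i i)
  partialSum≤partialSum+trace {n} A A₀ M A-sym A₀-sym M-psd A≈ F F₀ t = ≤-resp₂ (sym splitValues) refl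
    (+-mono-≤ (kyFan A₀ A₀-sym F₀ family t)
      (≤-trans (sum-mono λ j → ≤-resp₂ refl (*-identityˡ _)
          (*-monoʳ-≤ (f M j) (*-nonNeg (0≤weight j) (M-psd (vector j))) (initial≤1 (suc (Fin.toℕ t)) j)))
        (≤-reflexive (rayleighSum≈trace family M))))
    where
    open Eigenframe F
    χ = initial (suc (Fin.toℕ t))
    f : Matrix n → Vector Carrier n
    f B j = weight j * (vector j ∙ (B · vector j))
    value≈f : ∀ j → value j ≈ f A₀ j + f M j
    value≈f j = begin
      value j                                    ≈⟨ *-identityʳ _ ⟨
      value j * 1#                               ≈⟨ *-congˡ (normalised j) ⟨
      value j * (weight j * (vector j ∙ vector j)) ≈⟨ solve 3 (λ a q n → a :* (q :* n) := q :* (a :* n)) refl (value j) (weight j) (vector j ∙ vector j) ⟩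
      weight j * (value j * (vector j ∙ vector j)) ≈⟨ *-congˡ (eigenvector-∙ A A-sym (eigenvector j) (vector j)) ⟨
      weight j * ((A · vector j) ∙ vector j)     ≈⟨ *-congˡ (∙-comm _ (vector j)) ⟩
      weight j * (vector j ∙ (A · vector j))     ≈⟨ *-congˡ (∙-congˡ {x = vector j} λ i → trans (∙-comm (A i) (vector j))
                                                    (trans (∙-congˡ {x = vector j} (A≈ i)) (trans (∙-+ʳ (vector j) (A₀ i) (M i))
                                                      (+-cong (∙-comm (vector j) (A₀ i)) (∙-comm (vector j) (M i)))))) ⟩
      weight j * (vector j ∙ λ i → (A₀ · vector j) i + (M · vector j) i) ≈⟨ *-congˡ (∙-+ʳ (vector j) _ _) ⟩
      weight j * (vector j ∙ (A₀ · vector j) + vector j ∙ (M · vector j)) ≈⟨ distribˡ _ _ _ ⟩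
      f A₀ j + f M j                             ∎
    splitValues : χ ∙ value ≈ χ ∙ f A₀ + χ ∙ f M
    splitValues = trans (∙-congˡ {x = χ} value≈f) (∙-+ʳ χ (f A₀) (f M))

-- Splitting a quiver into its simple graph and the excess edges

module ℕ∑ = CommutativeMonoidSum ℕ.+-0-commutativeMonoid

if-yes : ∀ {a p} {A : Set a} {P : Set p} (P? : Dec P) {x y : A} → P → (if does P? then x else y) ≡ x
if-yes P? p = ≡.cong (if_then _ else _) (dec-true P? p)

if-no : ∀ {a p} {A : Set a} {P : Set p} (P? : Dec P) {x y : A} → ¬ P → (if does P? then x else y) ≡ y
if-no P? ¬p = ≡.cong (if_then _ else _) (dec-false P? ¬p)

ℤsum-pos : ∀ {n} (f : Vector ℕ n) → ℤΣ.sum (λ i → + f i) ≡ + ℕΣ.sum f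
ℤsum-pos {zero}  f = ≡.refl
ℤsum-pos {suc n} f = ≡.cong (λ z → + f zero ℤ.+ z) (ℤsum-pos (f ∘ suc))

module _ {n} (G : Quiver n) where
  open Quiver G

  -- All loops go to the excess. For distinct vertices the truncation `pred 0 = 0` matters: a pair
  -- that is not joined has no excess.
  simpleEdges excessEdges : Fin n → Fin n → ℕ
  simpleEdges i j = if does (i Fin.≟ j) then 0 else 1 ℕ.⊓ edges i j
  excessEdges i j = if does (i Fin.≟ j) then edges i j else ℕ.pred (edges i j)

  simplification excess : Quiver n
  simplification = record { edges = simpleEdges ; symmetric = sym′ }
    where
    sym′ : ∀ i j → simpleEdges i j ≡ simpleEdges j i
    sym′ i j with i Fin.≟ j
    ... | yes ≡.refl = ≡.sym (if-yes (i Fin.≟ i) ≡.refl)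
    ... | no i≢j     = ≡.trans (≡.cong (1 ℕ.⊓_) (symmetric i j)) (≡.sym (if-no (j Fin.≟ i) (i≢j ∘ ≡.sym)))
  excess = record { edges = excessEdges ; symmetric = sym′ }
    where
    sym′ : ∀ i j → excessEdges i j ≡ excessEdges j i
    sym′ i j with i Fin.≟ j
    ... | yes ≡.refl = ≡.sym (if-yes (i Fin.≟ i) ≡.refl)
    ... | no i≢j     = ≡.trans (≡.cong ℕ.pred (symmetric i j)) (≡.sym (if-no (j Fin.≟ i) (i≢j ∘ ≡.sym)))

  simplification-isSimple : IsSimple simplification
  simplification-isSimple = (λ i → if-yes (i Fin.≟ i) ≡.refl) , λ i j i≢j →
    ℕ.≤-trans (ℕ.≤-reflexive (if-no (i Fin.≟ j) i≢j)) (ℕ.m⊓n≤m 1 (edges i j))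

  1⊓e+pred : ∀ e → 1 ℕ.⊓ e ℕ.+ ℕ.pred e ≡ e
  1⊓e+pred zero    = ≡.refl
  1⊓e+pred (suc e) = ≡.refl

  edges-split : ∀ i j → edges i j ≡ simpleEdges i j ℕ.+ excessEdges i j
  edges-split i j with i Fin.≟ j
  ... | yes _ = ≡.refl
  ... | no  _ = ≡.sym (1⊓e+pred (edges i j))

  degree-split : ∀ i → degree G i ≡ degree simplification i ℕ.+ degree excess i
  degree-split i = ≡.trans (ℕΣ.sum-cong-≗ (edges-split i)) (ℕ∑.∑-distrib-+ (simpleEdges i) (excessEdges i))

  redundantBetween : Fin n → Fin n → ℕ
  redundantBetween i j = if does (i Fin.<? j) then ℕ.pred (edges i j) else 0

  redundantEdges : ℕ
  redundantEdges = ℕΣ.sum λ i → ℕΣ.sum (redundantBetween i)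

  signum-neg : ∀ e → signum (ℤ.- (+ e)) ℤ.- (ℤ.- (+ e)) ≡ + ℕ.pred e
  signum-neg zero    = ≡.refl
  signum-neg (suc e) = ≡.refl

  -- With `e` edges the signum is 0 or -1, so each integer summand is `pred e`. This moves the
  -- counting of edges from ℤ to ℕ.
  redundancy≡ : redundancy G ≡ + redundantEdges
  redundancy≡ = ≡.trans
    (ℤΣ.sum-cong-≗ λ i → ≡.trans (ℤΣ.sum-cong-≗ (term i)) (ℤsum-pos (redundantBetween i)))
    (ℤsum-pos λ i → ℕΣ.sum (redundantBetween i))
    where
    term : ∀ i j → (if does (i Fin.<? j) then signum (kirchhoff G i j) ℤ.- kirchhoff G i j else +0)
                   ≡ + redundantBetween i j
    term i j with Fin.<-cmp i j
    ... | tri< i<j i≢j _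
      rewrite dec-true (i Fin.<? j) i<j | dec-false (i Fin.≟ j) i≢j = signum-neg (edges i j)
    ... | tri≈ i≮j _ _ rewrite dec-false (i Fin.<? j) i≮j = ≡.refl
    ... | tri> i≮j _ _ rewrite dec-false (i Fin.<? j) i≮j = ≡.refl

  brouwerBound≡ : ∀ k → brouwerBound G k ≡ + (edgeCount G ℕ.+ redundantEdges ℕ.+ k ℕ.* suc k / 2)
  brouwerBound≡ k = ≡.cong (λ r → + edgeCount G ℤ.+ r ℤ.+ + (k ℕ.* suc k / 2)) redundancy≡

  totalDegree : ℕ
  totalDegree = ℕΣ.sum (degree G)

module _ {n} (G : Quiver n) where
  open Quiver G
  private
    G₀ = simplification G
    G₁ = excess G

  -- A loop contributes 1 to edgeCount and to the total degree, a redundant edge 1 to each of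
  -- edgeCount and redundancy and 2 to the total degree.
  edgeCount+redundantEdges : edgeCount G ℕ.+ redundantEdges G ≡
    edgeCount G₀ ℕ.+ redundantEdges G₀ ℕ.+ totalDegree G₁
  edgeCount+redundantEdges = begin
    edgeCount G ℕ.+ redundantEdges G
      ≡⟨ ∑∑-distrib-+ (upper edges) (redundant edges) ⟨
    ∑∑ (λ i j → upper edges i j ℕ.+ redundant edges i j)
      ≡⟨ ∑∑-cong termwise ⟩
    ∑∑ (λ i j → (upper e₀ i j ℕ.+ redundant e₀ i j) ℕ.+ (upper e₁ i j ℕ.+ strict i j))
      ≡⟨ ∑∑-distrib-+ (λ i j → upper e₀ i j ℕ.+ redundant e₀ i j) _ ⟩
    ∑∑ (λ i j → upper e₀ i j ℕ.+ redundant e₀ i j) ℕ.+ ∑∑ (λ i j → upper e₁ i j ℕ.+ strict i j)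
      ≡⟨ ≡.cong₂ ℕ._+_ (∑∑-distrib-+ (upper e₀) (redundant e₀)) symmetrise ⟩
    edgeCount G₀ ℕ.+ redundantEdges G₀ ℕ.+ totalDegree G₁ ∎
    where
    open ≡.≡-Reasoning
    e₀ = simpleEdges G
    e₁ = excessEdges G
    ∑∑ : (Fin n → Fin n → ℕ) → ℕ
    ∑∑ f = ℕΣ.sum λ i → ℕΣ.sum λ j → f i j
    ∑∑-cong : ∀ {f g} → (∀ i j → f i j ≡ g i j) → ∑∑ f ≡ ∑∑ g
    ∑∑-cong p = ℕΣ.sum-cong-≗ λ i → ℕΣ.sum-cong-≗ (p i)
    ∑∑-distrib-+ : ∀ f g → ∑∑ (λ i j → f i j ℕ.+ g i j) ≡ ∑∑ f ℕ.+ ∑∑ g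
    ∑∑-distrib-+ f g = ≡.trans (ℕΣ.sum-cong-≗ λ i → ℕ∑.∑-distrib-+ (f i) (g i)) (ℕ∑.∑-distrib-+ (λ i → ℕΣ.sum (f i)) _)
    upper redundant : (Fin n → Fin n → ℕ) → Fin n → Fin n → ℕ
    upper e i j = if does (i Fin.≤? j) then e i j else 0
    redundant e i j = if does (i Fin.<? j) then ℕ.pred (e i j) else 0
    strict : Fin n → Fin n → ℕ
    strict i j = if does (i Fin.<? j) then e₁ i j else 0
    multiplicity : ∀ e → e ℕ.+ ℕ.pred e ≡ (1 ℕ.⊓ e ℕ.+ ℕ.pred (1 ℕ.⊓ e)) ℕ.+ (ℕ.pred e ℕ.+ ℕ.pred e)
    multiplicity zero    = ≡.refl
    multiplicity (suc e) = ≡.refl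
    termwise : ∀ i j → upper edges i j ℕ.+ redundant edges i j ≡
      (upper e₀ i j ℕ.+ redundant e₀ i j) ℕ.+ (upper e₁ i j ℕ.+ strict i j)
    termwise i j with Fin.<-cmp i j
    ... | tri< i<j i≢j _
      rewrite dec-true (i Fin.<? j) i<j | dec-true (i Fin.≤? j) (ℕ.<⇒≤ i<j) | dec-false (i Fin.≟ j) i≢j
      = multiplicity (edges i j)
    ... | tri≈ i≮j i≡j _
      rewrite dec-false (i Fin.<? j) i≮j | dec-true (i Fin.≤? j) (Fin.≤-reflexive i≡j) | dec-true (i Fin.≟ j) i≡j
      = ≡.refl
    ... | tri> i≮j _ j<i
      rewrite dec-false (i Fin.<? j) i≮j | dec-false (i Fin.≤? j) (ℕ.<⇒≱ j<i) = ≡.refl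
    -- The upper triangle with diagonal and the transposed strict upper triangle together cover
    -- every ordered pair once.
    flip : ∀ i j → upper e₁ i j ℕ.+ strict j i ≡ e₁ i j
    flip i j with i Fin.≤? j
    ... | yes i≤j rewrite dec-true (i Fin.≤? j) i≤j | dec-false (j Fin.<? i) (ℕ.≤⇒≯ i≤j) = ℕ.+-identityʳ _
    ... | no  i≰j rewrite dec-false (i Fin.≤? j) i≰j | dec-true (j Fin.<? i) (ℕ.≰⇒> i≰j) = Quiver.symmetric G₁ j i
    symmetrise : ∑∑ (λ i j → upper e₁ i j ℕ.+ strict i j) ≡ totalDegree G₁
    symmetrise = begin
      ∑∑ (λ i j → upper e₁ i j ℕ.+ strict i j)      ≡⟨ ∑∑-distrib-+ (upper e₁) strict ⟩
      ∑∑ (upper e₁) ℕ.+ ∑∑ strict                   ≡⟨ ≡.cong (∑∑ (upper e₁) ℕ.+_) (ℕ∑.∑-comm strict) ⟩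
      ∑∑ (upper e₁) ℕ.+ ∑∑ (λ i j → strict j i)     ≡⟨ ∑∑-distrib-+ (upper e₁) _ ⟨
      ∑∑ (λ i j → upper e₁ i j ℕ.+ strict j i)      ≡⟨ ∑∑-cong flip ⟩
      totalDegree G₁                                ∎

  brouwerBound-split : ∀ k → brouwerBound G k ≡ brouwerBound G₀ k ℤ.+ + totalDegree G₁
  brouwerBound-split k = begin
    brouwerBound G k
      ≡⟨ brouwerBound≡ G k ⟩
    + (edgeCount G ℕ.+ redundantEdges G ℕ.+ T)
      ≡⟨ ≡.cong (λ m → + (m ℕ.+ T)) edgeCount+redundantEdges ⟩
    + (edgeCount G₀ ℕ.+ redundantEdges G₀ ℕ.+ totalDegree G₁ ℕ.+ T)
      ≡⟨ ≡.cong +_ (rearrange (edgeCount G₀ ℕ.+ redundantEdges G₀) (totalDegree G₁) T) ⟩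
    + (edgeCount G₀ ℕ.+ redundantEdges G₀ ℕ.+ T) ℤ.+ + totalDegree G₁
      ≡⟨ ≡.cong (ℤ._+ + totalDegree G₁) (brouwerBound≡ G₀ k) ⟨
    brouwerBound G₀ k ℤ.+ + totalDegree G₁ ∎
    where
    open ≡.≡-Reasoning
    T = k ℕ.* suc k / 2
    rearrange : ∀ a b c → a ℕ.+ b ℕ.+ c ≡ a ℕ.+ c ℕ.+ b
    rearrange = ℕSolver.solve-∀

  brouwerBound-suc : ∀ k → brouwerBound G (suc k) ≡ brouwerBound G k ℤ.+ + suc k
  brouwerBound-suc k = ≡.trans
    (≡.cong (λ t → + edgeCount G ℤ.+ redundancy G ℤ.+ + t) triangle)
    (≡.sym (ℤ.+-assoc (+ edgeCount G ℤ.+ redundancy G) (+ (k ℕ.* suc k / 2)) (+ suc k)))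
    where
    open ≡.≡-Reasoning
    triangle : suc k ℕ.* suc (suc k) / 2 ≡ k ℕ.* suc k / 2 ℕ.+ suc k
    triangle = begin
      suc k ℕ.* suc (suc k) / 2              ≡⟨ ≡.cong (_/ 2) (expand k) ⟩
      (k ℕ.* suc k ℕ.+ suc k ℕ.* 2) / 2      ≡⟨ +-distrib-/-∣ʳ (k ℕ.* suc k) (divides-refl (suc k)) ⟩
      k ℕ.* suc k / 2 ℕ.+ suc k ℕ.* 2 / 2    ≡⟨ ≡.cong (k ℕ.* suc k / 2 ℕ.+_) (m*n/n≡m (suc k) 2) ⟩
      k ℕ.* suc k / 2 ℕ.+ suc k              ∎
      where
      expand : ∀ k → suc k ℕ.* suc (suc k) ≡ k ℕ.* suc k ℕ.+ suc k ℕ.* 2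
      expand = ℕSolver.solve-∀

-- Kirchhoff matrices and the estimate for quivers

module QuiverSpectra (ℝ : RealNumbers) where
  open OrderedField ℝ
  open LinearAlgebra ℝ
  open SpectralTheorem ℝ
  open KyFan ℝ
  open Comparison ℝ
  open Spectral ℝ hiding (fromℕ; fromℤ)
  open ≈-Reasoning

  0≤fromℕ : ∀ k → 0# ≤ fromℕ k
  0≤fromℕ zero    = ≤-refl
  0≤fromℕ (suc k) = +-nonNeg 0≤1 (0≤fromℕ k)

  fromℕ-mono : ∀ {j k} → j ℕ.≤ k → fromℕ j ≤ fromℕ k
  fromℕ-mono {k = k} ℕ.z≤n = 0≤fromℕ k
  fromℕ-mono (ℕ.s≤s j≤k) = +-monoʳ-≤ 1# (fromℕ-mono j≤k)

  fromℕ-sum : ∀ {n} (f : Vector ℕ n) → fromℕ (ℕΣ.sum f) ≈ sum (λ i → fromℕ (f i))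
  fromℕ-sum {zero}  f = refl
  fromℕ-sum {suc n} f = trans (fromℕ-+ (f zero) _) (+-congˡ (fromℕ-sum (f ∘ suc)))

  kirchhoffMatrix : ∀ {n} → Quiver n → Matrix n
  kirchhoffMatrix G i j = fromℤ (kirchhoff G i j)

  module _ {n} (G : Quiver n) where
    open Quiver G

    kirchhoffMatrix-diagonal : ∀ i → kirchhoffMatrix G i i ≈ fromℕ (degree G i)
    kirchhoffMatrix-diagonal i = reflexive (≡.cong fromℤ (if-yes (i Fin.≟ i) ≡.refl))

    kirchhoffMatrix-offDiagonal : ∀ {i j} → i ≢ j → kirchhoffMatrix G i j ≈ - fromℕ (edges i j)
    kirchhoffMatrix-offDiagonal {i} {j} i≢j =
      trans (reflexive (≡.cong fromℤ (if-no (i Fin.≟ j) i≢j))) (fromℤ-neg (+ edges i j))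

    kirchhoffMatrix-sym : Symmetric (kirchhoffMatrix G)
    kirchhoffMatrix-sym i j = case i Fin.≟ j of λ where
      (yes ≡.refl) → refl
      (no i≢j)     → trans (kirchhoffMatrix-offDiagonal i≢j)
        (trans (-‿cong (reflexive (≡.cong fromℕ (symmetric i j)))) (sym (kirchhoffMatrix-offDiagonal (i≢j ∘ ≡.sym))))

    kirchhoffMatrix-split : ∀ i j → kirchhoffMatrix G i j ≈
      kirchhoffMatrix (simplification G) i j + kirchhoffMatrix (excess G) i j
    kirchhoffMatrix-split i j with i Fin.≟ j in eq
    ... | yes _ = trans (reflexive (≡.cong fromℕ (degree-split G i))) (fromℕ-+ (degree (simplification G) i) _)
    ... | no  _ = begin
      fromℤ (ℤ.- (+ edges i j))                         ≈⟨ fromℤ-neg (+ edges i j) ⟩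
      - fromℕ (edges i j)                               ≡⟨ ≡.cong (λ e → - fromℕ e) (1⊓e+pred G (edges i j)) ⟨
      - fromℕ (e₀ ℕ.+ e₁)                               ≈⟨ -‿cong (fromℕ-+ e₀ e₁) ⟩
      - (fromℕ e₀ + fromℕ e₁)                           ≈⟨ -‿+-comm _ _ ⟨
      - fromℕ e₀ - fromℕ e₁                             ≈⟨ +-cong (fromℤ-neg (+ e₀)) (fromℤ-neg (+ e₁)) ⟨
      fromℤ (ℤ.- (+ e₀)) + fromℤ (ℤ.- (+ e₁))           ∎
      where
      e₀ = 1 ℕ.⊓ edges i j
      e₁ = ℕ.pred (edges i j)

    kirchhoffMatrix-trace : sum (λ i → kirchhoffMatrix G i i) ≈ fromℕ (totalDegree G)
    kirchhoffMatrix-trace = trans (sum-cong-≋ kirchhoffMatrix-diagonal) (sym (fromℕ-sum (degree G)))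

    -- Loops contribute their number times `(x i)²`, and the edges between distinct `i` and `j`
    -- contribute their number times `(x i - x j)²`. Symmetrising the double sum over all ordered
    -- pairs and halving afterwards avoids sums over `i < j`.
    kirchhoffMatrix-psd : ∀ x → 0# ≤ x ∙ (kirchhoffMatrix G · x)
    kirchhoffMatrix-psd x = ≤-resp₂ refl (sym form) (halve (≤-resp₂ refl doubled
      (sum-nonNeg λ i → sum-nonNeg λ j → 0≤t+tᵀ i j)))
      where
      halve : ∀ {s} → 0# ≤ s + s → 0# ≤ s
      halve {s} p with total 0# s
      ... | inj₁ 0≤s = 0≤s
      ... | inj₂ s≤0 = ≤-trans p (≤-resp₂ refl (+-identityʳ s) (+-monoʳ-≤ s s≤0))
      -- The zero diagonal of `o` keeps the loops from cancelling: they enter the degree without a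
      -- matching negative entry.
      o t : Matrix n
      o i j = if does (i Fin.≟ j) then 0# else fromℕ (edges i j)
      t i j = x i * (fromℕ (edges i j) * x i - x j * o i j)
      K≈ : ∀ i j → kirchhoffMatrix G i j ≈ fromℕ (degree G i) * δ i j + - 1# * o i j
      K≈ i j with i Fin.≟ j
      ... | yes _ = trans (sym (+-identityʳ _)) (+-cong (sym (*-identityʳ _)) (sym (zeroʳ (- 1#))))
      ... | no  _ = trans (fromℤ-neg (+ edges i j))
        (sym (trans (+-cong (zeroʳ _) (-1*x≈-x _)) (+-identityˡ _)))
      row : ∀ i → kirchhoffMatrix G i ∙ x ≈ sum (λ j → fromℕ (edges i j) * x i - x j * o i j)
      row i = begin
        kirchhoffMatrix G i ∙ x
          ≈⟨ ∙-comm (kirchhoffMatrix G i) x ⟩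
        x ∙ kirchhoffMatrix G i
          ≈⟨ ∙-congˡ {x = x} (K≈ i) ⟩
        x ∙ (λ j → fromℕ (degree G i) * δ i j + - 1# * o i j)
          ≈⟨ ∙-linearʳ x (fromℕ (degree G i)) (- 1#) (δ i) (o i) ⟩
        fromℕ (degree G i) * (x ∙ δ i) + - 1# * (x ∙ o i)
          ≈⟨ +-cong (*-cong (fromℕ-sum (edges i)) (trans (∙-comm x (δ i)) (δ-∙ i x))) (*-distribˡ-sum {n} (- 1#) _) ⟩
        sum (λ j → fromℕ (edges i j)) * x i + sum (λ j → - 1# * (x j * o i j))
          ≈⟨ +-cong (*-distribʳ-sum {n} (x i) _) (sum-cong-≋ {n} λ j → -1*x≈-x (x j * o i j)) ⟩
        sum (λ j → fromℕ (edges i j) * x i) + sum (λ j → - (x j * o i j))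
          ≈⟨ ∑-distrib-+ (λ j → fromℕ (edges i j) * x i) _ ⟨
        sum (λ j → fromℕ (edges i j) * x i - x j * o i j) ∎
      form : x ∙ (kirchhoffMatrix G · x) ≈ sum (λ i → sum λ j → t i j)
      form = sum-cong-≋ λ i → trans (*-congˡ (row i)) (*-distribˡ-sum {n} (x i) _)
      doubled : sum (λ i → sum λ j → t i j + t j i) ≈ sum (λ i → sum λ j → t i j) + sum (λ i → sum λ j → t i j)
      doubled = begin
        sum (λ i → sum λ j → t i j + t j i)
          ≈⟨ sum-cong-≋ (λ i → ∑-distrib-+ (t i) (λ j → t j i)) ⟩
        sum (λ i → sum (t i) + sum (λ j → t j i))
          ≈⟨ ∑-distrib-+ (λ i → sum (t i)) _ ⟩
        sum (λ i → sum (t i)) + sum (λ i → sum (λ j → t j i))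
          ≈⟨ +-congˡ (∑-comm t) ⟨
        sum (λ i → sum λ j → t i j) + sum (λ i → sum λ j → t i j) ∎
      0≤t+tᵀ : ∀ i j → 0# ≤ t i j + t j i
      0≤t+tᵀ i j = case i Fin.≟ j of λ where
          (yes ≡.refl) → +-nonNeg (0≤tᵢᵢ i) (0≤tᵢᵢ i)
          (no i≢j)     → ≤-resp₂ refl (sym (offDiagonal i≢j)) (*-nonNeg (0≤fromℕ (edges i j)) (0≤x² (x i - x j)))
        where
        0≤tᵢᵢ : ∀ i → 0# ≤ t i i
        0≤tᵢᵢ i = ≤-resp₂ refl
          (trans (solve 2 (λ e x → e :* (x :* x) := x :* (e :* x :- x :* con (+ 0))) refl (fromℕ (edges i i)) (x i))
            (*-congˡ (+-congˡ (-‿cong (*-congˡ (reflexive (≡.sym (if-yes (i Fin.≟ i) ≡.refl))))))))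
          (*-nonNeg (0≤fromℕ (edges i i)) (0≤x² (x i)))
        offDiagonal : ∀ {i j} → i ≢ j → t i j + t j i ≈ fromℕ (edges i j) * ((x i - x j) * (x i - x j))
        offDiagonal {i} {j} i≢j = begin
          t i j + t j i
            ≡⟨ ≡.cong₂ _+_ (≡.cong (λ o → x i * (e * x i - x j * o)) (if-no (i Fin.≟ j) i≢j))
                           (≡.cong₂ (λ o e → x j * (e * x j - x i * o))
                             (≡.trans (if-no (j Fin.≟ i) (i≢j ∘ ≡.sym)) (≡.cong fromℕ (symmetric j i)))
                             (≡.cong fromℕ (symmetric j i))) ⟩
          x i * (e * x i - x j * e) + x j * (e * x j - x i * e)
            ≈⟨ solve 3 (λ e x y → x :* (e :* x :- y :* e) :+ y :* (e :* y :- x :* e) := e :* ((x :- y) :* (x :- y)))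
                 refl e (x i) (x j) ⟩
          e * ((x i - x j) * (x i - x j)) ∎
          where e = fromℕ (edges i j)

  module _ (s : ℕ ⁺) (simpleEstimate : BrouwerEstimateUpTo s) {n} .{{_ : NonZero n}} (G : Quiver n)
           (eig : Vector Carrier n) (spectrum : IsSpectrum (kirchhoff G) eig) where

    estimate : ∀ k → 1 ℕ.≤ k → (k≤n : k ℕ.≤ n) → [ k ] ≤ℕ⁺ s → partialSum eig k k≤n ≤ fromℤ (brouwerBound G k)
    estimate k@(suc k′) 1≤k k≤n k≤s = ≤-trans (sum-mono λ j → eig≤ (Fin.inject≤ j k≤n)) (≤-trans compare
      (≤-resp₂ (+-comm _ _) bounds (+-monoʳ-≤ (fromℕ (totalDegree G₁)) simpleBound)))
      where
      G₀ = simplification G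
      G₁ = excess G
      frame = eigenbasis (kirchhoffMatrix G) (kirchhoffMatrix-sym G)
      frame₀ = eigenbasis (kirchhoffMatrix G₀) (kirchhoffMatrix-sym G₀)
      module F = Eigenframe frame
      module F₀ = Eigenframe frame₀
      eig≤ : ∀ j → eig j ≤ F.value j
      eig≤ = let dec , v , ind , ev = spectrum in
        eigenvalue≤ (kirchhoffMatrix G) (kirchhoffMatrix-sym G) frame dec ind ev
      simpleBound : partialSum F₀.value k k≤n ≤ fromℤ (brouwerBound G₀ k)
      simpleBound = simpleEstimate n G₀ (simplification-isSimple G) F₀.value
        (F₀.decreasing , F₀.vector , F₀.independent , F₀.eigenvector) k 1≤k k≤n k≤s
      compare : partialSum F.value k k≤n ≤ partialSum F₀.value k k≤n + fromℕ (totalDegree G₁)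
      compare = ≤-resp₂ (initial-∙ k k≤n F.value) (+-cong (initial-∙ k k≤n F₀.value) (kirchhoffMatrix-trace G₁))
        -- The comparison is indexed by the last position counted; as `k` is `suc k′`, this is the
        -- element of `Fin n` with value `k′`.
        (≡.subst (λ l → initial (suc l) ∙ F.value ≤ initial (suc l) ∙ F₀.value + sum (λ i → kirchhoffMatrix G₁ i i))
          (Fin.toℕ-fromℕ< k≤n)
          (partialSum≤partialSum+trace (kirchhoffMatrix G) (kirchhoffMatrix G₀) (kirchhoffMatrix G₁)
            (kirchhoffMatrix-sym G) (kirchhoffMatrix-sym G₀) (kirchhoffMatrix-psd G₁) (kirchhoffMatrix-split G)
            frame frame₀ (Fin.fromℕ< k≤n)))
      bounds : fromℕ (totalDegree G₁) + fromℤ (brouwerBound G₀ k) ≈ fromℤ (brouwerBound G k)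
      bounds = trans (+-comm _ _) (trans (sym (fromℤ-+ (brouwerBound G₀ k) (+ totalDegree G₁)))
        (reflexive (≡.cong fromℤ (≡.sym (brouwerBound-split G k)))))

    beyondThreshold : ∀ s {k x} → ¬ ([ suc k ] ≤ℕ⁺ s) → [ x ] ≤ℝ⁺ fromℕ⁺ s → x ≤ fromℕ (suc k)
    beyondThreshold ⊤⁺    k≮s x≤s = contradiction (_ Sup.≤⊤⁺) k≮s
    beyondThreshold [ t ] k≮s x≤s = ≤-trans (Sup.[≤]-injective _≤_ x≤s)
      (fromℕ-mono (ℕ.<⇒≤ (ℕ.≰⇒> (k≮s ∘ Sup.[_]))))

    -- Starting the induction at 0, where an empty sum meets a natural number, spares locating `s`:
    -- each `suc k` is either within the threshold and treated directly, or beyond it and reduced to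
    -- `k`.
    quiverEstimate : [ largest eig ] ≤ℝ⁺ fromℕ⁺ s → ∀ k (k≤n : k ℕ.≤ n) →
      partialSum eig k k≤n ≤ fromℤ (brouwerBound G k)
    quiverEstimate λ₁≤s zero    k≤n = ≡.subst (λ b → 0# ≤ fromℤ b) (≡.sym (brouwerBound≡ G 0))
      (0≤fromℕ (edgeCount G ℕ.+ redundantEdges G ℕ.+ 0))
    quiverEstimate λ₁≤s (suc k) k≤n with Sup.≤⁺-dec ℕ._≤_ ℕ._≤?_ [ suc k ] s
    ... | yes k<s = estimate (suc k) (ℕ.s≤s ℕ.z≤n) k≤n k<s
    ... | no  k≮s = ≤-resp₂ (sym (sum-init-last {k} (λ j → eig (Fin.inject≤ j k≤n)))) bounds
      (+-mono-≤ (≤-resp₂ (sum-cong-≋ {k} λ j → reflexive (≡.cong eig (init≡ j))) refl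
                  (quiverEstimate λ₁≤s k (ℕ.<⇒≤ k≤n)))
        -- `largest eig` sits at index 0, so monotonicity bounds the newly added eigenvalue by it.
        (≤-trans (proj₁ spectrum (ℕ.≤-trans (ℕ.≤-reflexive (Fin.toℕ-fromℕ< (ℕ.>-nonZero⁻¹ n))) ℕ.z≤n))
          (beyondThreshold s k≮s λ₁≤s)))
      where
      init≡ : ∀ j → Fin.inject≤ j (ℕ.<⇒≤ k≤n) ≡ Fin.inject≤ (Fin.inject₁ j) k≤n
      init≡ j = Fin.toℕ-injective (≡.trans (Fin.toℕ-inject≤ j _)
        (≡.sym (≡.trans (Fin.toℕ-inject≤ (Fin.inject₁ j) k≤n) (Fin.toℕ-inject₁ j))))
      bounds : fromℤ (brouwerBound G k) + fromℕ (suc k) ≈ fromℤ (brouwerBound G (suc k))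
      bounds = trans (sym (fromℤ-+ (brouwerBound G k) (+ suc k))) (reflexive (≡.cong fromℤ (≡.sym (brouwerBound-suc G k))))

corollary1 :
    (ℝ : RealNumbers) →
    let open RealNumbers ℝ
        open Spectral ℝ
    in
    (s : ℕ ⁺) → IsBrouwerThreshold s →
    ∀ n .{{_ : NonZero n}} (G : Quiver n) →
    (eig : Vector Carrier n) → IsSpectrum (kirchhoff G) eig →
    [ largest eig ] ≤ℝ⁺ fromℕ⁺ s →
    ∀ k → 1 ℕ.≤ k → (k≤n : k ℕ.≤ n) →
    partialSum eig k k≤n ≤ fromℤ (brouwerBound G k)
corollary1 ℝ s (simpleEstimate , _) n G eig spectrum λ₁≤s k _ k≤n =
  QuiverSpectra.quiverEstimate ℝ s simpleEstimate G eig spectrum λ₁≤s k k≤n
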